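{- Every valid sequent is provable in $\mathrm{MTL}^2_\infty$. That is, if a sequent $\Gamma\vdash\Delta$ of formulas in $F_{e,r}\cup F_{e,l}$ is true in every structure, then $\Gamma\vdash\Delta$ is derivable in the sequent calculus $\mathrm{MTL}^2_\infty$.
   Context: **Syntax.** The internal relational language $L_{i,r}=\{f,<,c\}$ is a first-order language with equality ($f$ unary function, $<$ binary relation, $c$ constant), with a countably infinite set $V_i$ of variables $x,y,z,\dots$; $T_i$ is its set of terms $s,t,\dots$. Put $f^0(t)=t$, $f^{n+1}(t)=f(f^n(t))$. The set $F_{i,r}$ of internal relational formulas consists of the finitary first-order $L_{i,r}$-formulas together with the formula $\forall x\bigvee_{n\in\omega}(x<f^n(c))$ and all its subformulas, i.e. also $\bigvee_{n\in\omega}(t<f^n(c))$ and $t<f^k(c)$ for all $t\in T_i$, $k\in\omega$. The external relational language $L_{e,r}=\{F,<,C\}$, its variables $V_e$ ($X,Y,Z,\dots$), terms $T_e$ ($S,T,\dots$) and formulas $F_{e,r}$ are defined in exactly the same way with upper-case symbols. In both languages $u\le v$ abbreviates $u<v\lor u=v$. Temporal operators: for all $m<n$ in $\omega$, $\Box_{[m,n]},\Box_{]m,n]},\Box_{[m,n[},\Box_{]m,n[},\Box_{[m,\infty[},\Box_{]m,\infty[}$; $\Box_{(m,n)}$ denotes any of them ($n\in\omega\cup\{\infty\}$). The set $F_{i,t}$ of internal temporal formulas is the least set containing the propositional letters $\mathbf P=\{p_n:n\in\omega\}$ and closed under the propositional connectives and all $\Box_{(m,n)}$. $F_{i,l}$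 is the set of expressions $s:\psi$ with $s\in T_i$, $\psi\in F_{i,t}$. $\overline F_{i,l}$ is the closure of $F_{i,l}$ under (external) propositional connectives and (external) temporal operators; the elements of $F_{i,l}$ are the atomic formulas of $\overline F_{i,l}$. $F_{e,l}$ is the set of expressions $S:\beta$ with $S\in T_e$ and $\beta\in\overline F_{i,l}\cup F_{i,r}$. A sequent is $\Gamma\vdash\Delta$ with $\Gamma,\Delta$ finite (possibly empty) lists of formulas in $F_{e,r}\cup F_{e,l}$. **Semantics.** Call a first-order structure $(M,<,0,g)$ admissible if $(M,<,0)$ is a dense linear ordering with least element $0$ and no greatest element, $g:M\to M$ is strictly increasing, $a<g(a)$ for all $a\in M$, and $\{g^n(0):n\in\omega\}$ is cofinal in $M$. A pre-structure is $(\mathbf M,\mathbf N_a)_{a\in M}$ with $\mathbf M=(M,<,0,g)$ admissible and, for each $a\in M$, $\mathbf N_a=(N_a,<_a,0_a,g_a)$ admissible. A structure $\mathcal M=(\mathbf M,\mathbf N_a,(p^{\mathbf N_a})_{p\in\mathbf P},\sigma,\sigma_a)_{a\in M}$ based on it consists of it together with subsets $p^{\mathbf N_a}\subseteq N_a$ ($p\in\mathbf P$, $a\in M$), an assignment $\sigma:V_e\to M$ and assignments $\sigma_a:V_i\to N_a$. The symbols $F,<,C$ are interpreted in $\mathbf M$ by $g,<,0$, and $f,<,c$ in $\mathbf N_a$ by $g_a,<_a,0_a$. - Formulas of $F_{e,r}$ are evaluated in $\mathbf M,\sigma$, and formulas of $F_{i,r}$ in $\mathbf N_a,\sigma_a$,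 by first-order semantics (with the obvious meaning of $\bigvee$). - For $t\in T_i$ with value $b$ in $\mathbf N_a,\sigma_a$: $\mathbf N_a,\sigma_a\models t:p$ iff $b\in p^{\mathbf N_a}$; connectives as usual, e.g. $t:\eta\to\xi$ holds iff $t:\eta$ fails or $t:\xi$ holds; $t:\Box_{[m,n]}\psi$ holds iff for all $d\in N_a$ with $g_a^m(b)\le_a d\le_a g_a^n(b)$, $\mathbf N_a,\sigma_a(x/d)\models x:\psi$ (where $\sigma_a(x/d)$ sends $x$ to $d$ and otherwise agrees with $\sigma_a$). For the other operators, an endpoint whose bracket is turned outwards gives the corresponding strict inequality, and if the right endpoint is $\infty$ there is no upper bound. - For $T\in T_e$ with value $a$ in $\mathbf M,\sigma$: $\mathcal M\models T:\varphi$ (for $\varphi\in F_{i,r}$) iff $\mathbf N_a,\sigma_a\models\varphi$; $\mathcal M\models T:t:\psi$ iff $\mathbf N_a,\sigma_a\models t:\psi$; connectives as usual; $\mathcal M\models T:\Box_{[m,n]}\eta$ (for $\eta\in\overline F_{i,l}$) iff for all $d\in M$ with $g^m(a)\le d\le g^n(a)$, the structure obtained from $\mathcal M$ by replacing $\sigma$ with $\sigma(X/d)$ satisfies $X:\eta$; other operators similarly. A sequent $\Gamma\vdash\Delta$ is true in $\mathcal M$ if $\mathcal M$ fails to satisfy some formula of $\Gamma$ or satisfies some formula of $\Delta$; it is valid if true in all structures. **The calculus $\mathrm{MTL}^2_\infty$.** Axioms (an instance of a schema is obtained by replacing its displayed variables by arbitrary terms of the same kind): 1. *id*: $A\vdash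 A$ for every $A\in F_{e,r}\cup F_{e,l}$. 2. Equality axioms: all instances of $\vdash X=X$ and $X=Y,\rho[X/Z]\vdash\rho[Y/Z]$ ($\rho$ atomic in $F_{e,r}$); all instances of $\vdash T:x=x$ and $T:x=y,\ T:\rho[x/z]\vdash T:\rho[y/z]$ ($T\in T_e$, $\rho$ atomic in $F_{i,r}$); $T=S,\ T:\eta\vdash S:\eta$ for $S,T\in T_e$, $\eta$ atomic in $\overline F_{i,l}\cup F_{i,r}$; and its internal version $T:t=s,\ T:t:p\vdash T:s:p$ ($T\in T_e$, $s,t\in T_i$, $p\in\mathbf P$). 3. External extralogical axioms, all instances of: $X<X\vdash$; $X<Y,Y<Z\vdash X<Z$; $\vdash X<Y,X=Y,Y<X$; $\vdash C<X,C=X$; $X<Y\vdash\exists Z(X<Z\land Z<Y)$; $\vdash X<F(X)$; $X<Y\vdash F(X)<F(Y)$; $\vdash\bigvee_{n\in\omega}(X<F^n(C))$. Internal extralogical axioms: the same with $x,y,z,f,c$ in place of $X,Y,Z,F,C$ and every formula prefixed by the same label $T:$, for each $T\in T_e$. Rules: - Cut (from $\Gamma\vdash A,\Delta$ and $\Gamma,A\vdash\Delta$ infer $\Gamma\vdash\Delta$), Weakening, Exchange, Contraction, for all formulas of $F_{e,r}\cup F_{e,l}$. - For external relational formulas: the usual left and right rules of first-order classical sequent calculus for the finitary connectives and quantifiers (with the usual eigenvariable conditions), and for infinitary disjunction: from $\{\Gamma,T<F^n(C)\vdash\Delta\}_{n\in\omega}$ infer $\Gamma,\bigvee_{n\in\omega}(T<F^n(C))\vdash\Delta$;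 from $\Gamma\vdash T<F^m(C),\Delta$ (any $m\in\omega$) infer $\Gamma\vdash\bigvee_{n\in\omega}(T<F^n(C)),\Delta$. The same rules, internally, for formulas $T:\rho$ with $\rho\in F_{i,r}$ (all active formulas carry the same label $T$). - Propositional rules for labelled formulas: the usual left and right rules with the label $T$ attached to all active formulas $T:\alpha$, $T:\beta$, where $\alpha,\beta\in\overline F_{i,l}$ or $\alpha,\beta\in F_{i,r}$; and the internal versions with double label $T:t:$ attached to active formulas $\eta,\xi\in F_{i,t}$. E.g. from $\Gamma,T:t:\eta\vdash T:t:\xi,\Delta$ infer $\Gamma\vdash T:t:\eta\to\xi,\Delta$. - External temporal rules for $\Box_{[m,n]}$ ($\alpha\in\overline F_{i,l}$). Right: from $\Gamma,F^m(T)\le X,X\le F^n(T)\vdash X:\alpha,\Delta$ infer $\Gamma\vdash T:\Box_{[m,n]}\alpha,\Delta$, where $X$ is not free in $\Gamma\cup\Delta\cup\{T\}$. Left: from $\Gamma\vdash F^m(T)\le S,\Delta$; $\Gamma\vdash S\le F^n(T),\Delta$; and $\Gamma,S:\alpha\vdash\Delta$ infer $\Gamma,T:\Box_{[m,n]}\alpha\vdash\Delta$. - Internal temporal rules for $\Box_{[m,n]}$ ($\eta\in F_{i,t}$). Right: from $\Gamma,T:f^m(t)\le x,T:x\le f^n(t)\vdash T:x:\eta,\Delta$ infer $\Gamma\vdash T:t:\Box_{[m,n]}\eta,\Delta$, where $x$ is not free in $\Gamma\cup\Delta\cup\{t\}$. Left: from $\Gamma\vdash T:f^m(t)\le s,\Delta$;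 $\Gamma\vdash T:s\le f^n(t),\Delta$; and $\Gamma,T:s:\eta\vdash\Delta$ infer $\Gamma,T:t:\Box_{[m,n]}\eta\vdash\Delta$. - For the other temporal operators the rules are the same with $\le$ replaced by $<$ at each open endpoint, and with the upper-bound formula (respectively premise) omitted when the right endpoint is $\infty$. Proofs are well-founded derivation trees (each branch finite, the height possibly infinite because of the infinitary rules) whose leaves are axioms; a sequent is provable if it has a proof. -}

module Defs where

open import Data.Empty using (⊥)
open import Data.Fin using (Fin; zero; suc)
open import Data.List using (List; []; _∷_; [_]; _++_; concatMap)
open import Data.List.Membership.Propositional using (_∉_)
open import Data.List.Relation.Binary.Permutation.Propositional using (_↭_)
open import Data.List.Relation.Unary.All using (All)
open import Data.List.Relation.Unary.Any using (Any)
open import Data.Nat using (ℕ; zero; suc) renaming (_<_ to _<ℕ_)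
open import Data.Nat.GeneralisedArithmetic using (fold)
open import Data.Product using (_×_; ∃; ∃-syntax)
open import Data.Sum using (_⊎_)
open import Data.Vec using (Vec; []; _∷_; lookup)
open import Relation.Binary using (Rel; IsDenseLinearOrder; Minimum; Maximum; _Preserves_⟶_)
open import Relation.Binary.Construct.StrictToNonStrict as NonStrict using ()
open import Relation.Binary.PropositionalEquality using (_≡_)
open import Relation.Nullary using (¬_)
open import Level using (0ℓ)

------------------------------------------------------------------------
-- Syntax

-- The internal and external relational languages, {f,<,c} and {F,<,C};
-- both are written in lower case and told apart by the index.
data Lang : Set where
  int ext : Lang

Var : Set
Var = ℕ

-- Formulas are taken up to renaming of bound variables: free variables
-- are named by ℕ, bound ones are de Bruijn indices below k.  Terms and
-- formulas in the usual sense are those with k = 0.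
data Term (ℒ : Lang) (k : ℕ) : Set where
  free  : Var → Term ℒ k
  bound : Fin k → Term ℒ k
  c     : Term ℒ k
  f     : Term ℒ k → Term ℒ k

Tᵢ Tₑ : Set
Tᵢ = Term int 0
Tₑ = Term ext 0

f^ : ∀ {ℒ k} → ℕ → Term ℒ k → Term ℒ k
f^ n t = fold t f n

data Bracket : Set where
  closed open′ : Bracket

-- An open′ bracket is one turned outwards, e.g. ]m,n] is
-- bounded open′ closed m n and [m,∞[ is unbounded closed m.
data Interval : Set where
  bounded   : (l r : Bracket) (m n : ℕ) → .(m <ℕ n) → Interval
  unbounded : (l : Bracket) (m : ℕ) → Interval

-- rel ℒ k : finitary first-order formulas of ℒ (k bound variables in scope)
-- temp    : internal temporal formulas
-- lab     : closure of the formulas t : ψ (ψ temporal) under external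
--           connectives and external temporal operators
data Kind : Set where
  rel  : Lang → ℕ → Kind
  temp : Kind
  lab  : Kind

infix  9 _≐_ _≺_ _≼_
infix  8 _∶_
infix  8 ∼_ ∀∙_ ∃∙_
infixr 7 _∧_
infixr 6 _∨_
infixr 5 _⇒_

data Form : Kind → Set where
  _≐_ _≺_     : ∀ {ℒ k} → Term ℒ k → Term ℒ k → Form (rel ℒ k)
  ∀∙_ ∃∙_     : ∀ {ℒ k} → Form (rel ℒ (suc k)) → Form (rel ℒ k)
  p           : ℕ → Form temp
  □ⁱ          : Interval → Form temp → Form temp
  _∶_         : Tᵢ → Form temp → Form lab
  □ᵉ          : Interval → Form lab → Form lab
  ∼_          : ∀ {κ} → Form κ → Form κ
  _∧_ _∨_ _⇒_ : ∀ {κ} → Form κ → Form κ → Form κ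

_≼_ : ∀ {ℒ k} → Term ℒ k → Term ℒ k → Form (rel ℒ k)
s ≼ t = s ≺ t ∨ s ≐ t

data Atomic : ∀ {κ} → Form κ → Set where
  ≐-atomic : ∀ {ℒ k} {s t : Term ℒ k} → Atomic (s ≐ t)
  ≺-atomic : ∀ {ℒ k} {s t : Term ℒ k} → Atomic (s ≺ t)
  ∶-atomic : ∀ {t ψ} → Atomic (t ∶ ψ)

-- Relational formulas.  The only infinitary formulas are
-- ⋁[ t <fⁿc] = ⋁ₙ (t < fⁿ(c)) and ∀⋁ = ∀x ⋁ₙ (x < fⁿ(c)), and nothing
-- is built on top of them.
data RelForm (ℒ : Lang) : Set where
  fin     : Form (rel ℒ 0) → RelForm ℒ
  ⋁[_<fⁿc] : Term ℒ 0 → RelForm ℒ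
  ∀⋁      : RelForm ℒ

-- What an external label may be attached to.
data Body : Set where
  rel : RelForm int → Body
  lab : Form lab → Body

-- External relational formulas and externally labelled formulas.
data Formula : Set where
  rel : RelForm ext → Formula
  _∶_ : Tₑ → Body → Formula

-- The label carried by a formula of each kind inside a sequent: none,
-- T:, T:, and T:t: respectively.
data Label : Kind → Set where
  ε      : Label (rel ext 0)
  inRel  : Tₑ → Label (rel int 0)
  inLab  : Tₑ → Label lab
  inTemp : Tₑ → Tᵢ → Label temp

infix 4 _▸_ _▹_

_▹_ : ∀ {ℒ} → Label (rel ℒ 0) → RelForm ℒ → Formula
ε       ▹ ρ = rel ρ
inRel T ▹ ρ = T ∶ rel ρ

_▸_ : ∀ {κ} → Label κ → Form κ → Formula
ε          ▸ φ = rel (fin φ)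
inRel T    ▸ φ = T ∶ rel (fin φ)
inLab T    ▸ α = T ∶ lab α
inTemp T t ▸ ψ = T ∶ lab (t ∶ ψ)

------------------------------------------------------------------------
-- Substitution for bound variables

weaken : ∀ {ℒ k} → Term ℒ k → Term ℒ (suc k)
weaken (free x)  = free x
weaken (bound i) = bound (suc i)
weaken c         = c
weaken (f t)     = f (weaken t)

Subst : Lang → ℕ → ℕ → Set
Subst ℒ k l = Fin k → Term ℒ l

lift : ∀ {ℒ k l} → Subst ℒ k l → Subst ℒ (suc k) (suc l)
lift θ zero    = bound zero
lift θ (suc i) = weaken (θ i)

substT : ∀ {ℒ k l} → Subst ℒ k l → Term ℒ k → Term ℒ l
substT θ (free x)  = free x
substT θ (bound i) = θ i
substT θ c         = c
substT θ (f t)     = f (substT θ t)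

subst : ∀ {ℒ k l} → Subst ℒ k l → Form (rel ℒ k) → Form (rel ℒ l)
subst θ (s ≐ t) = substT θ s ≐ substT θ t
subst θ (s ≺ t) = substT θ s ≺ substT θ t
subst θ (∀∙ φ)  = ∀∙ subst (lift θ) φ
subst θ (∃∙ φ)  = ∃∙ subst (lift θ) φ
subst θ (∼ φ)   = ∼ subst θ φ
subst θ (φ ∧ χ) = subst θ φ ∧ subst θ χ
subst θ (φ ∨ χ) = subst θ φ ∨ subst θ χ
subst θ (φ ⇒ χ) = subst θ φ ⇒ subst θ χ

infix 10 _⟨_⟩

_⟨_⟩ : ∀ {ℒ} → Form (rel ℒ 1) → Term ℒ 0 → Form (rel ℒ 0)
φ ⟨ t ⟩ = subst (λ _ → t) φ

------------------------------------------------------------------------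
-- Free variables of each language

fvT : ∀ {ℒ k} → Term ℒ k → List Var
fvT (free x)  = [ x ]
fvT (bound i) = []
fvT c         = []
fvT (f t)     = fvT t

-- For kind rel ℒ k these are variables of ℒ; for kind lab they are
-- internal variables, the only ones that occur.
fvF : ∀ {κ} → Form κ → List Var
fvF (s ≐ t)  = fvT s ++ fvT t
fvF (s ≺ t)  = fvT s ++ fvT t
fvF (∀∙ φ)   = fvF φ
fvF (∃∙ φ)   = fvF φ
fvF (p n)    = []
fvF (□ⁱ I ψ) = []
fvF (t ∶ ψ)  = fvT t
fvF (□ᵉ I α) = fvF α
fvF (∼ φ)    = fvF φ
fvF (φ ∧ χ)  = fvF φ ++ fvF χ
fvF (φ ∨ χ)  = fvF φ ++ fvF χ
fvF (φ ⇒ χ)  = fvF φ ++ fvF χ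

fvR : ∀ {ℒ} → RelForm ℒ → List Var
fvR (fin φ)      = fvF φ
fvR ⋁[ t <fⁿc] = fvT t
fvR ∀⋁           = []

fv : Lang → Formula → List Var
fv ext (rel ρ)     = fvR ρ
fv ext (T ∶ β)     = fvT T
fv int (rel ρ)     = []
fv int (T ∶ rel ρ) = fvR ρ
fv int (T ∶ lab α) = fvF α

fvs : Lang → List Formula → List Var
fvs ℒ = concatMap (fv ℒ)

------------------------------------------------------------------------
-- The calculus MTL²∞

cmp : ∀ {ℒ} → Bracket → Term ℒ 0 → Term ℒ 0 → Form (rel ℒ 0)
cmp closed s t = s ≼ t
cmp open′  s t = s ≺ t

-- The formulas expressing that s lies in the interval I relative to t.
bounds : ∀ {ℒ} → Interval → Term ℒ 0 → Term ℒ 0 → List (Form (rel ℒ 0))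
bounds (bounded l r m n _) t s = cmp l (f^ m t) s ∷ cmp r s (f^ n t) ∷ []
bounds (unbounded l m)     t s = cmp l (f^ m t) s ∷ []

infixr 5 _▸▸_
_▸▸_ : ∀ {κ} → Label κ → List (Form κ) → List Formula
π ▸▸ φs = Data.List.map (π ▸_) φs

private variable
  Γ Γ′ Δ Δ′ : List Formula
  A B       : Formula
  κ         : Kind
  ℒ         : Lang

infix 3 _⊢_

-- Active formulas stand at the head of either list.
data _⊢_ : List Formula → List Formula → Set where

  id : A ∷ [] ⊢ A ∷ []

  -- equality axioms; in eq-subst the bound variable of ρ plays the role
  -- of the variable substituted for
  eq-refl  : (π : Label (rel ℒ 0)) (t : Term ℒ 0) →
             [] ⊢ (π ▸ t ≐ t) ∷ []
  eq-subst : (π : Label (rel ℒ 0)) (s t : Term ℒ 0)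
             (ρ : Form (rel ℒ 1)) → Atomic ρ →
             (π ▸ s ≐ t) ∷ (π ▸ ρ ⟨ s ⟩) ∷ [] ⊢ (π ▸ ρ ⟨ t ⟩) ∷ []
  eq-rel   : (T S : Tₑ) (η : Form (rel int 0)) → Atomic η →
             (ε ▸ T ≐ S) ∷ (inRel T ▸ η) ∷ [] ⊢ (inRel S ▸ η) ∷ []
  eq-lab   : (T S : Tₑ) (η : Form lab) → Atomic η →
             (ε ▸ T ≐ S) ∷ (inLab T ▸ η) ∷ [] ⊢ (inLab S ▸ η) ∷ []
  eq-prop  : (T : Tₑ) (t s : Tᵢ) (n : ℕ) →
             (inRel T ▸ t ≐ s) ∷ (inTemp T t ▸ p n) ∷ [] ⊢ (inTemp T s ▸ p n) ∷ []

  -- extralogical axioms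
  <-irrefl : (π : Label (rel ℒ 0)) (s : Term ℒ 0) →
             (π ▸ s ≺ s) ∷ [] ⊢ []
  <-trans  : (π : Label (rel ℒ 0)) (s t u : Term ℒ 0) →
             (π ▸ s ≺ t) ∷ (π ▸ t ≺ u) ∷ [] ⊢ (π ▸ s ≺ u) ∷ []
  <-linear : (π : Label (rel ℒ 0)) (s t : Term ℒ 0) →
             [] ⊢ (π ▸ s ≺ t) ∷ (π ▸ s ≐ t) ∷ (π ▸ t ≺ s) ∷ []
  c-least  : (π : Label (rel ℒ 0)) (s : Term ℒ 0) →
             [] ⊢ (π ▸ c ≺ s) ∷ (π ▸ c ≐ s) ∷ []
  <-dense  : (π : Label (rel ℒ 0)) (s t : Term ℒ 0) →
             (π ▸ s ≺ t) ∷ [] ⊢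
             (π ▸ ∃∙ (weaken s ≺ bound zero ∧ bound zero ≺ weaken t)) ∷ []
  f-incr   : (π : Label (rel ℒ 0)) (s : Term ℒ 0) →
             [] ⊢ (π ▸ s ≺ f s) ∷ []
  f-mono   : (π : Label (rel ℒ 0)) (s t : Term ℒ 0) →
             (π ▸ s ≺ t) ∷ [] ⊢ (π ▸ f s ≺ f t) ∷ []
  f-cofinal : (π : Label (rel ℒ 0)) (s : Term ℒ 0) →
             [] ⊢ (π ▹ ⋁[ s <fⁿc]) ∷ []

  -- structural rules
  cut       : Γ ⊢ A ∷ Δ → A ∷ Γ ⊢ Δ → Γ ⊢ Δ
  weakenL   : Γ ⊢ Δ → A ∷ Γ ⊢ Δ
  weakenR   : Γ ⊢ Δ → Γ ⊢ A ∷ Δ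
  exchange  : Γ ↭ Γ′ → Δ ↭ Δ′ → Γ ⊢ Δ → Γ′ ⊢ Δ′
  contractL : A ∷ A ∷ Γ ⊢ Δ → A ∷ Γ ⊢ Δ
  contractR : Γ ⊢ A ∷ A ∷ Δ → Γ ⊢ A ∷ Δ

  -- propositional rules, for all four kinds of label
  ∼L : (π : Label κ) (φ : Form κ) →
       Γ ⊢ (π ▸ φ) ∷ Δ → (π ▸ ∼ φ) ∷ Γ ⊢ Δ
  ∼R : (π : Label κ) (φ : Form κ) →
       (π ▸ φ) ∷ Γ ⊢ Δ → Γ ⊢ (π ▸ ∼ φ) ∷ Δ
  ∧L : (π : Label κ) (φ χ : Form κ) →
       (π ▸ φ) ∷ (π ▸ χ) ∷ Γ ⊢ Δ → (π ▸ φ ∧ χ) ∷ Γ ⊢ Δ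
  ∧R : (π : Label κ) (φ χ : Form κ) →
       Γ ⊢ (π ▸ φ) ∷ Δ → Γ ⊢ (π ▸ χ) ∷ Δ → Γ ⊢ (π ▸ φ ∧ χ) ∷ Δ
  ∨L : (π : Label κ) (φ χ : Form κ) →
       (π ▸ φ) ∷ Γ ⊢ Δ → (π ▸ χ) ∷ Γ ⊢ Δ → (π ▸ φ ∨ χ) ∷ Γ ⊢ Δ
  ∨R : (π : Label κ) (φ χ : Form κ) →
       Γ ⊢ (π ▸ φ) ∷ (π ▸ χ) ∷ Δ → Γ ⊢ (π ▸ φ ∨ χ) ∷ Δ
  ⇒L : (π : Label κ) (φ χ : Form κ) →
       Γ ⊢ (π ▸ φ) ∷ Δ → (π ▸ χ) ∷ Γ ⊢ Δ → (π ▸ φ ⇒ χ) ∷ Γ ⊢ Δ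
  ⇒R : (π : Label κ) (φ χ : Form κ) →
       (π ▸ φ) ∷ Γ ⊢ (π ▸ χ) ∷ Δ → Γ ⊢ (π ▸ φ ⇒ χ) ∷ Δ

  -- quantifiers; the eigenvariable is not free in the conclusion
  ∀L : (π : Label (rel ℒ 0)) (φ : Form (rel ℒ 1)) (t : Term ℒ 0) →
       (π ▸ φ ⟨ t ⟩) ∷ Γ ⊢ Δ → (π ▸ ∀∙ φ) ∷ Γ ⊢ Δ
  ∀R : (π : Label (rel ℒ 0)) (φ : Form (rel ℒ 1)) (x : Var) →
       x ∉ fvs ℒ (Γ ++ (π ▸ ∀∙ φ) ∷ Δ) →
       Γ ⊢ (π ▸ φ ⟨ free x ⟩) ∷ Δ → Γ ⊢ (π ▸ ∀∙ φ) ∷ Δ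
  ∃L : (π : Label (rel ℒ 0)) (φ : Form (rel ℒ 1)) (x : Var) →
       x ∉ fvs ℒ ((π ▸ ∃∙ φ) ∷ Γ ++ Δ) →
       (π ▸ φ ⟨ free x ⟩) ∷ Γ ⊢ Δ → (π ▸ ∃∙ φ) ∷ Γ ⊢ Δ
  ∃R : (π : Label (rel ℒ 0)) (φ : Form (rel ℒ 1)) (t : Term ℒ 0) →
       Γ ⊢ (π ▸ φ ⟨ t ⟩) ∷ Δ → Γ ⊢ (π ▸ ∃∙ φ) ∷ Δ

  -- the quantifier rules for the infinitary formula ∀x ⋁ₙ (x < fⁿ(c))
  ∀⋁L : (π : Label (rel ℒ 0)) (t : Term ℒ 0) →
        (π ▹ ⋁[ t <fⁿc]) ∷ Γ ⊢ Δ → (π ▹ ∀⋁) ∷ Γ ⊢ Δ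
  ∀⋁R : (π : Label (rel ℒ 0)) (x : Var) →
        x ∉ fvs ℒ (Γ ++ Δ) →
        Γ ⊢ (π ▹ ⋁[ free x <fⁿc]) ∷ Δ → Γ ⊢ (π ▹ ∀⋁) ∷ Δ

  -- infinitary disjunction
  ⋁L : (π : Label (rel ℒ 0)) (t : Term ℒ 0) →
       (∀ n → (π ▸ t ≺ f^ n c) ∷ Γ ⊢ Δ) → (π ▹ ⋁[ t <fⁿc]) ∷ Γ ⊢ Δ
  ⋁R : (π : Label (rel ℒ 0)) (t : Term ℒ 0) (m : ℕ) →
       Γ ⊢ (π ▸ t ≺ f^ m c) ∷ Δ → Γ ⊢ (π ▹ ⋁[ t <fⁿc]) ∷ Δ

  -- temporal rules
  □ᵉR : (I : Interval) (T : Tₑ) (α : Form lab) (X : Var) →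
        X ∉ fvs ext (Γ ++ Δ) ++ fvT T →
        (ε ▸▸ bounds I T (free X)) ++ Γ ⊢ (inLab (free X) ▸ α) ∷ Δ →
        Γ ⊢ (inLab T ▸ □ᵉ I α) ∷ Δ
  □ᵉL : (I : Interval) (T S : Tₑ) (α : Form lab) →
        All (λ φ → Γ ⊢ (ε ▸ φ) ∷ Δ) (bounds I T S) →
        (inLab S ▸ α) ∷ Γ ⊢ Δ →
        (inLab T ▸ □ᵉ I α) ∷ Γ ⊢ Δ
  □ⁱR : (I : Interval) (T : Tₑ) (t : Tᵢ) (η : Form temp) (x : Var) →
        x ∉ fvs int (Γ ++ Δ) ++ fvT t →
        (inRel T ▸▸ bounds I t (free x)) ++ Γ ⊢ (inTemp T (free x) ▸ η) ∷ Δ →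
        Γ ⊢ (inTemp T t ▸ □ⁱ I η) ∷ Δ
  □ⁱL : (I : Interval) (T : Tₑ) (t s : Tᵢ) (η : Form temp) →
        All (λ φ → Γ ⊢ (inRel T ▸ φ) ∷ Δ) (bounds I t s) →
        (inTemp T s ▸ η) ∷ Γ ⊢ Δ →
        (inTemp T t ▸ □ⁱ I η) ∷ Γ ⊢ Δ

------------------------------------------------------------------------
-- Semantics

record Admissible : Set₁ where
  infix 4 _<_ _≤_
  field
    Carrier : Set
    _<_     : Rel Carrier 0ℓ
    0#      : Carrier
    g       : Carrier → Carrier

  _≤_ : Rel Carrier 0ℓ
  _≤_ = NonStrict._≤_ _≡_ _<_

  g^ : ℕ → Carrier → Carrier
  g^ n a = fold a g n

  field
    isDenseLinearOrder : IsDenseLinearOrder _≡_ _<_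
    0-least            : Minimum _≤_ 0#
    no-greatest        : ¬ (∃[ a ] Maximum _≤_ a)
    g-strictMono       : g Preserves _<_ ⟶ _<_
    g-incr             : ∀ a → a < g a
    g-cofinal          : ∀ a → ∃[ n ] a ≤ g^ n 0#

  compare : Bracket → Rel Carrier 0ℓ
  compare closed = _≤_
  compare open′  = _<_

  -- d lies in the interval I relative to b
  Within : Interval → Carrier → Carrier → Set
  Within (bounded l r m n _) b d = compare l (g^ m b) d × compare r d (g^ n b)
  Within (unbounded l m)     b d = compare l (g^ m b) d

∣_∣ : Admissible → Set
∣ N ∣ = Admissible.Carrier N

module _ (N : Admissible) where
  open Admissible N

  value : ∀ {ℒ k} → (Var → Carrier) → Vec Carrier k → Term ℒ k → Carrier
  value σ ρ (free x)  = σ x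
  value σ ρ (bound i) = lookup ρ i
  value σ ρ c         = 0#
  value σ ρ (f t)     = g (value σ ρ t)

  -- ρ assigns values to the bound variables in scope.
  SatFO : ∀ {ℒ k} → (Var → Carrier) → Vec Carrier k → Form (rel ℒ k) → Set
  SatFO σ ρ (s ≐ t) = value σ ρ s ≡ value σ ρ t
  SatFO σ ρ (s ≺ t) = value σ ρ s < value σ ρ t
  SatFO σ ρ (∀∙ φ)  = ∀ d → SatFO σ (d ∷ ρ) φ
  SatFO σ ρ (∃∙ φ)  = ∃[ d ] SatFO σ (d ∷ ρ) φ
  SatFO σ ρ (∼ φ)   = ¬ SatFO σ ρ φ
  SatFO σ ρ (φ ∧ χ) = SatFO σ ρ φ × SatFO σ ρ χ
  SatFO σ ρ (φ ∨ χ) = SatFO σ ρ φ ⊎ SatFO σ ρ χ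
  SatFO σ ρ (φ ⇒ χ) = SatFO σ ρ φ → SatFO σ ρ χ

  SatRel : ∀ {ℒ} → (Var → Carrier) → RelForm ℒ → Set
  SatRel σ (fin φ)      = SatFO σ [] φ
  SatRel σ ⋁[ t <fⁿc] = ∃[ n ] value σ [] t < g^ n 0#
  SatRel σ ∀⋁           = ∀ d → ∃[ n ] d < g^ n 0#

  -- Truth of an internal temporal formula at a point.  As ψ contains no
  -- variables, x : ψ under σ(x/d) is just the truth of ψ at d.
  SatTemp : (ℕ → Carrier → Set) → Carrier → Form temp → Set
  SatTemp P b (p n)    = P n b
  SatTemp P b (□ⁱ I ψ) = ∀ d → Within I b d → SatTemp P d ψ
  SatTemp P b (∼ ψ)    = ¬ SatTemp P b ψ
  SatTemp P b (ψ ∧ χ)  = SatTemp P b ψ × SatTemp P b χ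
  SatTemp P b (ψ ∨ χ)  = SatTemp P b ψ ⊎ SatTemp P b χ
  SatTemp P b (ψ ⇒ χ)  = SatTemp P b ψ → SatTemp P b χ

record Structure : Set₁ where
  field
    𝐌  : Admissible
    𝐍  : ∣ 𝐌 ∣ → Admissible
    P  : ∀ a → ℕ → ∣ 𝐍 a ∣ → Set
    σ  : Var → ∣ 𝐌 ∣
    σᵢ : ∀ a → Var → ∣ 𝐍 a ∣

module _ (ℳ : Structure) where
  open Structure ℳ

  -- Truth of a formula at a point of 𝐌.  As α contains no external
  -- variables, X : α under σ(X/d) is just the truth of α at d.
  SatLab : ∣ 𝐌 ∣ → Form lab → Set
  SatLab a (t ∶ ψ)  = SatTemp (𝐍 a) (P a) (value (𝐍 a) (σᵢ a) [] t) ψ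
  SatLab a (□ᵉ I α) = ∀ d → Admissible.Within 𝐌 I a d → SatLab d α
  SatLab a (∼ α)    = ¬ SatLab a α
  SatLab a (α ∧ β)  = SatLab a α × SatLab a β
  SatLab a (α ∨ β)  = SatLab a α ⊎ SatLab a β
  SatLab a (α ⇒ β)  = SatLab a α → SatLab a β

  SatBody : ∣ 𝐌 ∣ → Body → Set
  SatBody a (rel ρ) = SatRel (𝐍 a) (σᵢ a) ρ
  SatBody a (lab α) = SatLab a α

  Sat : Formula → Set
  Sat (rel ρ) = SatRel 𝐌 σ ρ
  Sat (T ∶ β) = SatBody (value 𝐌 σ [] T) β

  True : List Formula → List Formula → Set
  True Γ Δ = Any (λ A → ¬ Sat A) Γ ⊎ Any Sat Δ

Valid : List Formula → List Formula → Set₁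
Valid Γ Δ = ∀ ℳ → True ℳ Γ Δ

{-# OPTIONS --safe #-}

-- A Henkin construction.  From an unprovable sequent, cut yields an increasing sequence of
-- unprovable sequents that decides every formula and supplies a witness for each left ∃ and
-- ⋁ₙ (t < fⁿ(c)) and for each right ∀ and □; the infinitary rule is what lets ⋁ₙ (t < fⁿ(c)) be
-- instantiated by a single n.  The limit determines a term model, whose external points are
-- external terms and whose internal points at T are internal terms, modulo provable equality.
-- The truth lemma speaks of arbitrary terms and labels naming a given point, so congruence is
-- needed for atomic formulas only, where it is an axiom.
module Submission where

open import Defs
open import Axiom.ExcludedMiddle using (ExcludedMiddle)
open import Data.Empty using (⊥)
open import Data.Fin using (zero; suc)
open import Data.List using (List; []; _∷_; _++_; map; concat; concatMap; upTo; allFin;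
                             cartesianProduct; cartesianProductWith)
open import Data.List.Membership.Propositional using (_∈_; _∉_)
open import Data.List.Membership.Propositional.Properties
open import Data.List.Relation.Binary.Permutation.Propositional using (_↭_; prep; ↭-refl; ↭-sym)
open import Data.List.Relation.Binary.Permutation.Propositional.Properties using (shift; ++-comm)
open import Data.List.Relation.Binary.Subset.Propositional using (_⊆_)
open import Data.List.Relation.Unary.All as All using (All; []; _∷_)
import Data.List.Relation.Unary.All.Properties as All
open import Data.List.Relation.Unary.Any as Any using (Any; here; there)
open import Data.Nat using (ℕ; zero; suc; _+_; _*_; _∸_; _≤_; _<_; _⊔_; z≤n; s≤s; _<?_)
open import Data.Nat.GeneralisedArithmetic using (fold)
open import Data.Nat.ListAction using (sum)
open import Data.Nat.Properties hiding (<-trans; <-irrefl; _<?_)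
open import Data.Product using (_×_; _,_; ∃; ∃-syntax; ∃₂; proj₁; proj₂)
open import Data.Product.Function.NonDependent.Propositional using (_×-⇔_)
open import Data.Sum using (_⊎_; inj₁; inj₂; [_,_]′)
open import Data.Sum.Function.Propositional using (_⊎-⇔_)
open import Data.Vec as Vec using (Vec; []; _∷_; lookup)
open import Data.Vec.Properties using (lookup-map)
open import Function using (_∘_; _$_; case_of_)
open import Function.Bundles using (_⇔_; mk⇔; Equivalence)
open import Function.Construct.Composition using (_⇔-∘_)
open import Function.Construct.Symmetry using (⇔-sym)
open import Function.Related.TypeIsomorphisms using (→-cong-⇔; ¬-cong-⇔)
open import Level using (0ℓ)
open import Relation.Binary using (Tri; tri<; tri≈; tri>)
open import Relation.Binary.PropositionalEquality using (_≡_; refl; sym; trans; cong; cong₂; isEquivalence)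
  renaming (subst to transport)
open import Relation.Nullary using (¬_; yes; no; contradiction)
open import Relation.Nullary.Decidable using (recompute)

open Equivalence using (to; from)

private variable
  X Y       : Set
  Γ Γ′ Δ Δ′ : List Formula
  A         : Formula
  κ         : Kind
  ℒ         : Lang
  k l m n   : ℕ

-- Canonical representatives

-- `c` goes to 0, variables to positive even numbers and applications of `f` to odd ones. The coding
-- serves to pick one term from each class of provably equal terms, namely the one of least code.
code : Term ℒ 0 → ℕ
code c        = 0
code (free x) = 2 * suc x
code (f t)    = suc (2 * code t)

code-injective : (s t : Term ℒ 0) → code s ≡ code t → s ≡ t
code-injective (free x) (free y) eq = cong free (suc-injective (*-cancelˡ-≡ _ _ 2 eq))
code-injective (free x) (f t)    eq = contradiction eq (even≢odd (suc x) (code t))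
code-injective c        c        eq = refl
code-injective (f s)    (free y) eq = contradiction (sym eq) (even≢odd (suc y) (code s))
code-injective (f s)    (f t)    eq = cong f (code-injective s t (*-cancelˡ-≡ _ _ 2 (suc-injective eq)))

-- The search runs upwards from 0 by shifting `Q`, and the known solution `n` bounds it.
least : ExcludedMiddle 0ℓ → (Q : ℕ → Set) → ∀ n → Q n → ∃[ k ] Q k × (∀ m → Q m → k ≤ m)
least em Q zero    q = zero , q , λ _ _ → z≤n
least em Q (suc n) q with em {Q 0} | least em (Q ∘ suc) n q
... | yes q₀ | _            = zero , q₀ , λ _ _ → z≤n
... | no ¬q₀ | k , qₖ , min = suc k , qₖ , λ where
  zero    q₀ → contradiction q₀ ¬q₀
  (suc m) q′ → s≤s (min m q′)

-- Substitution

substT-weaken : (s t : Term ℒ 0) → substT {k = 1} (λ _ → t) (weaken s) ≡ s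
substT-weaken (free x) t = refl
substT-weaken c        t = refl
substT-weaken (f s)    t = cong f (substT-weaken s t)

substT-lift-weaken : (θ : Subst ℒ k l) (t : Term ℒ k) → substT (lift θ) (weaken t) ≡ weaken (substT θ t)
substT-lift-weaken θ (free x)  = refl
substT-lift-weaken θ (bound i) = refl
substT-lift-weaken θ c         = refl
substT-lift-weaken θ (f t)     = cong f (substT-lift-weaken θ t)

substT-id : {θ : Subst ℒ k k} → (∀ i → θ i ≡ bound i) → ∀ t → substT θ t ≡ t
substT-id θ≗ (free x)  = refl
substT-id θ≗ (bound i) = θ≗ i
substT-id θ≗ c         = refl
substT-id θ≗ (f t)     = cong f (substT-id θ≗ t)

lift-id : {θ : Subst ℒ k k} → (∀ i → θ i ≡ bound i) → ∀ i → lift θ i ≡ bound i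
lift-id θ≗ zero    = refl
lift-id θ≗ (suc i) = cong weaken (θ≗ i)

subst-id : {θ : Subst ℒ k k} → (∀ i → θ i ≡ bound i) → ∀ φ → subst θ φ ≡ φ
subst-id θ≗ (s ≐ t) = cong₂ _≐_ (substT-id θ≗ s) (substT-id θ≗ t)
subst-id θ≗ (s ≺ t) = cong₂ _≺_ (substT-id θ≗ s) (substT-id θ≗ t)
subst-id θ≗ (∀∙ φ)  = cong ∀∙_ (subst-id (lift-id θ≗) φ)
subst-id θ≗ (∃∙ φ)  = cong ∃∙_ (subst-id (lift-id θ≗) φ)
subst-id θ≗ (∼ φ)   = cong ∼_ (subst-id θ≗ φ)
subst-id θ≗ (φ ∧ χ) = cong₂ _∧_ (subst-id θ≗ φ) (subst-id θ≗ χ)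
subst-id θ≗ (φ ∨ χ) = cong₂ _∨_ (subst-id θ≗ φ) (subst-id θ≗ χ)
subst-id θ≗ (φ ⇒ χ) = cong₂ _⇒_ (subst-id θ≗ φ) (subst-id θ≗ χ)

module _ {k l m} {τ : Subst ℒ l m} {θ : Subst ℒ k l} {υ : Subst ℒ k m}
         (τ∘θ≗υ : ∀ i → substT τ (θ i) ≡ υ i) where

  substT-∘ : ∀ t → substT τ (substT θ t) ≡ substT υ t
  substT-∘ (free x)  = refl
  substT-∘ (bound i) = τ∘θ≗υ i
  substT-∘ c         = refl
  substT-∘ (f t)     = cong f (substT-∘ t)

  lift-∘ : ∀ i → substT (lift τ) (lift θ i) ≡ lift υ i
  lift-∘ zero    = refl
  lift-∘ (suc i) = trans (substT-lift-weaken τ (θ i)) (cong weaken (τ∘θ≗υ i))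

subst-∘ : ∀ {k l m} {τ : Subst ℒ l m} {θ : Subst ℒ k l} {υ : Subst ℒ k m} →
          (∀ i → substT τ (θ i) ≡ υ i) → ∀ φ → subst τ (subst θ φ) ≡ subst υ φ
subst-∘ eq (s ≐ t) = cong₂ _≐_ (substT-∘ eq s) (substT-∘ eq t)
subst-∘ eq (s ≺ t) = cong₂ _≺_ (substT-∘ eq s) (substT-∘ eq t)
subst-∘ eq (∀∙ φ)  = cong ∀∙_ (subst-∘ (lift-∘ eq) φ)
subst-∘ eq (∃∙ φ)  = cong ∃∙_ (subst-∘ (lift-∘ eq) φ)
subst-∘ eq (∼ φ)   = cong ∼_ (subst-∘ eq φ)
subst-∘ eq (φ ∧ χ) = cong₂ _∧_ (subst-∘ eq φ) (subst-∘ eq χ)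
subst-∘ eq (φ ∨ χ) = cong₂ _∨_ (subst-∘ eq φ) (subst-∘ eq χ)
subst-∘ eq (φ ⇒ χ) = cong₂ _⇒_ (subst-∘ eq φ) (subst-∘ eq χ)

-- This carries the truth lemma under a quantifier: instantiating the body after closing it by `θ`
-- amounts to closing it by the environment extended with `t`.
subst-lift-⟨⟩ : (θ : Vec (Term ℒ 0) k) (φ : Form (rel ℒ (suc k))) (t : Term ℒ 0) →
                subst (lift (lookup θ)) φ ⟨ t ⟩ ≡ subst (lookup (t ∷ θ)) φ
subst-lift-⟨⟩ θ φ t = subst-∘ (λ { zero → refl ; (suc i) → substT-weaken (lookup θ i) t }) φ

-- Enumeration of the formulas

-- Abstract, hence injective for unification, unlike _++_.
abstract
  union : List (List X) → List X
  union = concat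

  ∈-union : {a : X} {xs : List X} {xss : List (List X)} → a ∈ xs → xs ∈ xss → a ∈ union xss
  ∈-union = ∈-concat⁺′

pattern first  = here refl
pattern second = there first
pattern third  = there second
pattern fourth = there third
pattern fifth  = there fourth
pattern sixth  = there fifth

-- Membership is asked at all large levels, so that the two components of a pair meet at the maximum
-- of their levels.
Eventually : (ℕ → List X) → X → Set
Eventually e a = ∃[ N ] ∀ {n} → N ≤ n → a ∈ e n

module _ {e : ℕ → List X} {a : X} where

  ev-suc : Eventually (e ∘ suc) a → Eventually e a
  ev-suc (N , a∈) = suc N , λ where (s≤s N≤n) → a∈ N≤n

  ev-map : (h : X → Y) → Eventually e a → Eventually (λ n → map h (e n)) (h a)
  ev-map h (N , a∈) = N , λ N≤n → ∈-map⁺ h (a∈ N≤n)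

  ev-∪ : {es : ℕ → List (List X)} → (∀ {n} → e n ∈ es n) → Eventually e a → Eventually (union ∘ es) a
  ev-∪ e∈es (N , a∈) = N , λ N≤n → ∈-union (a∈ N≤n) e∈es

  ev-zip : {Z : Set} {e′ : ℕ → List Y} {b : Y} (h : X → Y → Z) → Eventually e a → Eventually e′ b →
           Eventually (λ n → cartesianProductWith h (e n) (e′ n)) (h a b)
  ev-zip h (N , a∈) (N′ , b∈) = N ⊔ N′ , λ {n} N⊔N′≤n →
    ∈-cartesianProductWith⁺ h (a∈ (m⊔n≤o⇒m≤o N N′ N⊔N′≤n)) (b∈ (m⊔n≤o⇒n≤o N N′ N⊔N′≤n))

ev-upTo : ∀ i → Eventually upTo i
ev-upTo i = suc i , ∈-upTo⁺

ev-const : {a : X} {xs : List X} → a ∈ xs → Eventually (λ _ → xs) a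
ev-const a∈ = 0 , λ _ → a∈

terms : ∀ {ℒ k} → ℕ → List (Term ℒ k)
terms zero            = []
terms {k = k} (suc n) = union (map free (upTo n) ∷ map bound (allFin k) ∷ (c ∷ []) ∷ map f (terms n) ∷ [])

ev-terms : (t : Term ℒ k) → Eventually terms t
ev-terms (free x)  = ev-suc (ev-∪ first (ev-map free (ev-upTo x)))
ev-terms (bound i) = ev-suc (ev-∪ second (ev-const (∈-map⁺ bound (∈-allFin i))))
ev-terms c         = ev-suc (ev-∪ third (ev-const first))
ev-terms (f t)     = ev-suc (ev-∪ fourth (ev-map f (ev-terms t)))

brackets : List Bracket
brackets = closed ∷ open′ ∷ []

ev-brackets : ∀ l → Eventually (λ _ → brackets) l
ev-brackets closed = ev-const first
ev-brackets open′  = ev-const second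

boundedIntervals : (Bracket × Bracket) × (ℕ × ℕ) → List Interval
boundedIntervals ((l , r) , (m , n)) with m <? n
... | yes m<n = bounded l r m n m<n ∷ []
... | no  _   = []

-- The proof of `m < n` inside an interval is irrelevant, so the one found by the decision procedure
-- yields the very same interval.
∈-boundedIntervals : ∀ l r m n .(m<n : m < n) → bounded l r m n m<n ∈ boundedIntervals ((l , r) , (m , n))
∈-boundedIntervals l r m n m<n with m <? n
... | yes _   = here refl
... | no  m≮n = contradiction (recompute (m <? n) m<n) m≮n

intervals : ℕ → List Interval
intervals n = union
  ( concatMap boundedIntervals (cartesianProduct (cartesianProduct brackets brackets) (cartesianProduct (upTo n) (upTo n)))
  ∷ cartesianProductWith unbounded brackets (upTo n)
  ∷ [])

ev-intervals : ∀ I → Eventually intervals I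
ev-intervals (bounded l r m n m<n) = ev-∪ first (ev-concatMap
  (ev-zip _,_ (ev-zip _,_ (ev-brackets l) (ev-brackets r)) (ev-zip _,_ (ev-upTo m) (ev-upTo n))))
  where
  ev-concatMap : ∀ {e} → Eventually e ((l , r) , (m , n)) →
                 Eventually (concatMap boundedIntervals ∘ e) (bounded l r m n m<n)
  ev-concatMap (N , p∈) = N , λ N≤n →
    ∈-concatMap⁺ _ (Any.map (λ where refl → ∈-boundedIntervals l r m n m<n) (p∈ N≤n))
ev-intervals (unbounded l m) = ev-∪ second (ev-zip unbounded (ev-brackets l) (ev-upTo m))

-- The connectives are common to all kinds; `nonprops` covers the constructors that depend on the
-- kind. The recursion is on the level alone, so the number of bound variables may grow under a
-- quantifier.
forms    : ∀ κ → ℕ → List (Form κ)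
nonprops : ∀ κ → ℕ → List (Form κ)

forms κ zero    = []
forms κ (suc n) = union
  ( nonprops κ n
  ∷ map ∼_ (forms κ n)
  ∷ cartesianProductWith _∧_ (forms κ n) (forms κ n)
  ∷ cartesianProductWith _∨_ (forms κ n) (forms κ n)
  ∷ cartesianProductWith _⇒_ (forms κ n) (forms κ n)
  ∷ [])

nonprops (rel ℒ k) n = union
  ( cartesianProductWith _≐_ (terms n) (terms n)
  ∷ cartesianProductWith _≺_ (terms n) (terms n)
  ∷ map ∀∙_ (forms (rel ℒ (suc k)) n)
  ∷ map ∃∙_ (forms (rel ℒ (suc k)) n)
  ∷ [])
nonprops temp n = union (map p (upTo n) ∷ cartesianProductWith □ⁱ (intervals n) (forms temp n) ∷ [])
nonprops lab  n = union
  ( cartesianProductWith _∶_ (terms n) (forms temp n)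
  ∷ cartesianProductWith □ᵉ (intervals n) (forms lab n)
  ∷ [])

ev-nonprops : {φ : Form κ} → Eventually (nonprops κ) φ → Eventually (forms κ) φ
ev-nonprops e = ev-suc (ev-∪ first e)

ev-forms : (φ : Form κ) → Eventually (forms κ) φ
ev-forms (s ≐ t)  = ev-nonprops (ev-∪ first (ev-zip _≐_ (ev-terms s) (ev-terms t)))
ev-forms (s ≺ t)  = ev-nonprops (ev-∪ second (ev-zip _≺_ (ev-terms s) (ev-terms t)))
ev-forms (∀∙ φ)   = ev-nonprops (ev-∪ third (ev-map ∀∙_ (ev-forms φ)))
ev-forms (∃∙ φ)   = ev-nonprops (ev-∪ fourth (ev-map ∃∙_ (ev-forms φ)))
ev-forms (p n)    = ev-nonprops (ev-∪ first (ev-map p (ev-upTo n)))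
ev-forms (□ⁱ I ψ) = ev-nonprops (ev-∪ second (ev-zip □ⁱ (ev-intervals I) (ev-forms ψ)))
ev-forms (t ∶ ψ)  = ev-nonprops (ev-∪ first (ev-zip _∶_ (ev-terms t) (ev-forms ψ)))
ev-forms (□ᵉ I α) = ev-nonprops (ev-∪ second (ev-zip □ᵉ (ev-intervals I) (ev-forms α)))
ev-forms (∼ φ)    = ev-suc (ev-∪ second (ev-map ∼_ (ev-forms φ)))
ev-forms (φ ∧ χ)  = ev-suc (ev-∪ third (ev-zip _∧_ (ev-forms φ) (ev-forms χ)))
ev-forms (φ ∨ χ)  = ev-suc (ev-∪ fourth (ev-zip _∨_ (ev-forms φ) (ev-forms χ)))
ev-forms (φ ⇒ χ)  = ev-suc (ev-∪ fifth (ev-zip _⇒_ (ev-forms φ) (ev-forms χ)))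

-- Labels, tasks and their enumeration

labels : ∀ κ → ℕ → List (Label κ)
labels (rel ext zero)    n = ε ∷ []
labels (rel int zero)    n = map inRel (terms n)
labels (rel ℒ   (suc _)) n = []
labels temp              n = cartesianProductWith inTemp (terms n) (terms n)
labels lab               n = map inLab (terms n)

ev-labels : (π : Label κ) → Eventually (labels κ) π
ev-labels ε            = ev-const first
ev-labels (inRel T)    = ev-map inRel (ev-terms T)
ev-labels (inLab T)    = ev-map inLab (ev-terms T)
ev-labels (inTemp T t) = ev-zip inTemp (ev-terms T) (ev-terms t)

-- A task asks either for a decision on a formula or for a Henkin witness. Infinitary formulas are
-- never put up for decision: they are theorems, and `cofinal` only asks for an `n` that realises
-- the disjunction.
data Task : Set where
  decide  : ∀ {κ} → Label κ → Form κ → Task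
  cofinal : ∀ {ℒ} → Label (rel ℒ 0) → Term ℒ 0 → Task
  all ex  : ∀ {ℒ} → Label (rel ℒ 0) → Form (rel ℒ 1) → Task
  boxᵉ    : Interval → Tₑ → Form lab → Task
  boxⁱ    : Interval → Tₑ → Tᵢ → Form temp → Task

-- Resolves τ Γ Δ: adding Γ to the left and Δ to the right of a sequent settles τ.
data Resolves : Task → List Formula → List Formula → Set where
  holds     : {π : Label κ} {φ : Form κ} → Resolves (decide π φ) ((π ▸ φ) ∷ []) []
  fails     : {π : Label κ} {φ : Form κ} → Resolves (decide π φ) [] ((π ▸ φ) ∷ [])
  below     : {π : Label (rel ℒ 0)} {t : Term ℒ 0} (n : ℕ) →
              Resolves (cofinal π t) ((π ▸ t ≺ f^ n c) ∷ []) []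
  ∀-true    : {π : Label (rel ℒ 0)} {φ : Form (rel ℒ 1)} → Resolves (all π φ) ((π ▸ ∀∙ φ) ∷ []) []
  ∀-false   : {π : Label (rel ℒ 0)} {φ : Form (rel ℒ 1)} (x : Var) →
              Resolves (all π φ) [] ((π ▸ φ ⟨ free x ⟩) ∷ [])
  ∃-false   : {π : Label (rel ℒ 0)} {φ : Form (rel ℒ 1)} → Resolves (ex π φ) [] ((π ▸ ∃∙ φ) ∷ [])
  ∃-true    : {π : Label (rel ℒ 0)} {φ : Form (rel ℒ 1)} (x : Var) →
              Resolves (ex π φ) ((π ▸ φ ⟨ free x ⟩) ∷ []) []
  □ᵉ-true   : ∀ {I T α} → Resolves (boxᵉ I T α) ((inLab T ▸ □ᵉ I α) ∷ []) []
  □ᵉ-false  : ∀ {I T α} (X : Var) →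
              Resolves (boxᵉ I T α) (ε ▸▸ bounds I T (free X)) ((inLab (free X) ▸ α) ∷ [])
  □ⁱ-true   : ∀ {I T t η} → Resolves (boxⁱ I T t η) ((inTemp T t ▸ □ⁱ I η) ∷ []) []
  □ⁱ-false  : ∀ {I T t η} (x : Var) →
              Resolves (boxⁱ I T t η) (inRel T ▸▸ bounds I t (free x)) ((inTemp T (free x) ▸ η) ∷ [])

decisions : Kind → ℕ → List Task
decisions κ n = cartesianProductWith decide (labels κ n) (forms κ n)

ev-decisions : (π : Label κ) (φ : Form κ) → Eventually (decisions κ) (decide π φ)
ev-decisions π φ = ev-zip decide (ev-labels π) (ev-forms φ)

relTasks : Lang → ℕ → List Task
relTasks ℒ n = union
  ( decisions (rel ℒ 0) n
  ∷ cartesianProductWith cofinal (labels (rel ℒ 0) n) (terms n)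
  ∷ cartesianProductWith all (labels (rel ℒ 0) n) (forms (rel ℒ 1) n)
  ∷ cartesianProductWith ex (labels (rel ℒ 0) n) (forms (rel ℒ 1) n)
  ∷ [])

tasks : ℕ → List Task
tasks n = union
  ( relTasks ext n
  ∷ relTasks int n
  ∷ decisions temp n
  ∷ decisions lab n
  ∷ cartesianProductWith _$_ (cartesianProductWith boxᵉ (intervals n) (terms n)) (forms lab n)
  ∷ cartesianProductWith _$_
      (cartesianProductWith _$_ (cartesianProductWith boxⁱ (intervals n) (terms n)) (terms n)) (forms temp n)
  ∷ [])

ev-relTasks : ∀ ℒ {τ} → Eventually (relTasks ℒ) τ → Eventually tasks τ
ev-relTasks ext e = ev-∪ first e
ev-relTasks int e = ev-∪ second e

ev-tasks : ∀ τ → Eventually tasks τ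
ev-tasks (decide ε φ)              = ev-relTasks ext (ev-∪ first (ev-decisions ε φ))
ev-tasks (decide π@(inRel _) φ)    = ev-relTasks int (ev-∪ first (ev-decisions π φ))
ev-tasks (decide π@(inTemp _ _) ψ) = ev-∪ third (ev-decisions π ψ)
ev-tasks (decide π@(inLab _) α)    = ev-∪ fourth (ev-decisions π α)
ev-tasks (cofinal {ℒ} π t)         = ev-relTasks ℒ (ev-∪ second (ev-zip cofinal (ev-labels π) (ev-terms t)))
ev-tasks (all {ℒ} π φ)             = ev-relTasks ℒ (ev-∪ third (ev-zip all (ev-labels π) (ev-forms φ)))
ev-tasks (ex {ℒ} π φ)              = ev-relTasks ℒ (ev-∪ fourth (ev-zip ex (ev-labels π) (ev-forms φ)))
ev-tasks (boxᵉ I T α)              = ev-∪ fifth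
  (ev-zip _$_ (ev-zip boxᵉ (ev-intervals I) (ev-terms T)) (ev-forms α))
ev-tasks (boxⁱ I T t η)            = ev-∪ sixth
  (ev-zip _$_ (ev-zip _$_ (ev-zip boxⁱ (ev-intervals I) (ev-terms T)) (ev-terms t)) (ev-forms η))

-- Unprovable sequents

fresh : (xs : List Var) → ∃[ x ] x ∉ xs
fresh xs = suc (sum xs) , λ x∈xs → 1+n≰n (∈⇒≤sum x∈xs)
  where
  ∈⇒≤sum : ∀ {x xs} → x ∈ xs → x ≤ sum xs
  ∈⇒≤sum (here refl)          = m≤m+n _ _
  ∈⇒≤sum (there {x = y} x∈xs) = m≤n⇒m≤o+n y (∈⇒≤sum x∈xs)

∈⇒↭ : {A : Formula} → A ∈ Γ → ∃[ Γ′ ] Γ ↭ A ∷ Γ′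
∈⇒↭ {A = A} A∈Γ with ∈-∃++ A∈Γ
... | Γ₁ , Γ₂ , refl = Γ₁ ++ Γ₂ , shift A Γ₁ Γ₂

-- Each formula of `Γ` is contracted with its copy further right, which exchange first brings next
-- to it.
absorbL : ∀ Γ → Γ ⊆ Γ′ → Γ ++ Γ′ ⊢ Δ → Γ′ ⊢ Δ
absorbL []      _    d = d
absorbL (A ∷ Γ) Γ⊆Γ′ d with ∈⇒↭ (∈-++⁺ʳ Γ (Γ⊆Γ′ (here refl)))
... | _ , eq = absorbL Γ (Γ⊆Γ′ ∘ there)
  (exchange (↭-sym eq) ↭-refl (contractL (exchange (prep A eq) ↭-refl d)))

absorbR : ∀ Δ → Δ ⊆ Δ′ → Γ ⊢ Δ ++ Δ′ → Γ ⊢ Δ′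
absorbR []      _    d = d
absorbR (A ∷ Δ) Δ⊆Δ′ d with ∈⇒↭ (∈-++⁺ʳ Δ (Δ⊆Δ′ (here refl)))
... | _ , eq = absorbR Δ (Δ⊆Δ′ ∘ there)
  (exchange ↭-refl (↭-sym eq) (contractR (exchange ↭-refl (prep A eq) d)))

weakenL* : ∀ Γ′ → Γ ⊢ Δ → Γ′ ++ Γ ⊢ Δ
weakenL* []       d = d
weakenL* (_ ∷ Γ′) d = weakenL (weakenL* Γ′ d)

weakenR* : ∀ Δ′ → Γ ⊢ Δ → Γ ⊢ Δ′ ++ Δ
weakenR* []       d = d
weakenR* (_ ∷ Δ′) d = weakenR (weakenR* Δ′ d)

-- Both target lists are added by weakening, and the original ones are then absorbed into them. From
-- here on only the sets of formulas of a sequent matter.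
⊢-mono : Γ ⊆ Γ′ → Δ ⊆ Δ′ → Γ ⊢ Δ → Γ′ ⊢ Δ′
⊢-mono {Γ} {Γ′} {Δ} {Δ′} Γ⊆ Δ⊆ d = absorbL Γ Γ⊆ (absorbR Δ Δ⊆
  (exchange (++-comm Γ′ Γ) (++-comm Δ′ Δ) (weakenL* Γ′ (weakenR* Δ′ d))))

assumption : A ∈ Γ → A ∈ Δ → Γ ⊢ Δ
assumption A∈Γ A∈Δ = ⊢-mono (λ { first → A∈Γ }) (λ { first → A∈Δ }) id

module _ (em : ExcludedMiddle 0ℓ) where

  ¬∀⇒∃¬ : {Q : X → Set} → ¬ (∀ x → Q x) → ∃[ x ] ¬ Q x
  ¬∀⇒∃¬ {Q = Q} ¬∀ with em {∃[ x ] ¬ Q x}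
  ... | yes ∃¬ = ∃¬
  ... | no ¬∃¬ = contradiction (λ x → case em of λ { (yes q) → q ; (no ¬q) → contradiction (x , ¬q) ¬∃¬ }) ¬∀

  -- If every way of settling the task gave a provable sequent, a cut would prove the original one.
  -- For `cofinal` the premises for all `n` are joined by `⋁L` and cut against `f-cofinal`; for
  -- quantifiers and boxes the rule with the eigenvariable supplies one side of the cut.
  resolution : ∀ τ → ¬ (Γ ⊢ Δ) → ∃₂ λ Γ′ Δ′ → Resolves τ Γ′ Δ′ × ¬ (Γ′ ++ Γ ⊢ Δ′ ++ Δ)
  resolution {Γ} {Δ} (decide π φ) ¬d with em {(π ▸ φ) ∷ Γ ⊢ Δ}
  ... | no ¬l = _ , _ , holds , ¬l
  ... | yes l = _ , _ , fails , λ r → ¬d (cut r l)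
  resolution (cofinal π t) ¬d
    with ¬∀⇒∃¬ (λ l → ¬d (cut (⊢-mono (λ ()) (λ { (here refl) → here refl }) (f-cofinal π t)) (⋁L π t l)))
  ... | n , ¬l = _ , _ , below n , ¬l
  resolution {Γ} {Δ} (all π φ) ¬d with em {(π ▸ ∀∙ φ) ∷ Γ ⊢ Δ}
  ... | no ¬l = _ , _ , ∀-true , ¬l
  -- The list to be avoided is read off from the eigenvariable condition of the rule applied next.
  ... | yes l with fresh _
  ... | x , x∉ = _ , _ , ∀-false x , λ r → ¬d (cut (∀R π φ x x∉ r) l)
  resolution {Γ} {Δ} (ex π φ) ¬d with em {Γ ⊢ (π ▸ ∃∙ φ) ∷ Δ}
  ... | no ¬r = _ , _ , ∃-false , ¬r
  ... | yes r with fresh _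
  ... | x , x∉ = _ , _ , ∃-true x , λ l → ¬d (cut r (∃L π φ x x∉ l))
  resolution {Γ} {Δ} (boxᵉ I T α) ¬d with em {(inLab T ▸ □ᵉ I α) ∷ Γ ⊢ Δ}
  ... | no ¬l = _ , _ , □ᵉ-true , ¬l
  ... | yes l with fresh _
  ... | X , X∉ = _ , _ , □ᵉ-false X , λ r → ¬d (cut (□ᵉR I T α X X∉ r) l)
  resolution {Γ} {Δ} (boxⁱ I T t η) ¬d with em {(inTemp T t ▸ □ⁱ I η) ∷ Γ ⊢ Δ}
  ... | no ¬l = _ , _ , □ⁱ-true , ¬l
  ... | yes l with fresh _
  ... | x , x∉ = _ , _ , □ⁱ-false x , λ r → ¬d (cut (□ⁱR I T t η x x∉ r) l)

  -- The increasing sequence of unprovable sequents and its limit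

  record Unprovable : Set where
    constructor _⊬_by_
    field
      left right : List Formula
      unprovable : ¬ (left ⊢ right)

  open Unprovable

  record _⊑_ (s s′ : Unprovable) : Set where
    constructor _,_
    field
      left-⊆  : left s ⊆ left s′
      right-⊆ : right s ⊆ right s′

  open _⊑_

  ⊑-refl : ∀ {s} → s ⊑ s
  ⊑-refl = (λ A∈ → A∈) , (λ A∈ → A∈)

  ⊑-trans : ∀ {s s′ s″} → s ⊑ s′ → s′ ⊑ s″ → s ⊑ s″
  ⊑-trans (l , r) (l′ , r′) = l′ ∘ l , r′ ∘ r

  Resolved : Task → Unprovable → Set
  Resolved τ s = ∃₂ λ Γ Δ → Resolves τ Γ Δ × (Γ ⊆ left s) × (Δ ⊆ right s)

  Resolved-mono : ∀ {s s′ τ} → s ⊑ s′ → Resolved τ s → Resolved τ s′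
  Resolved-mono (l , r) (Γ , Δ , ρ , Γ⊆ , Δ⊆) = Γ , Δ , ρ , l ∘ Γ⊆ , r ∘ Δ⊆

  resolve : ∀ τ s → ∃[ s′ ] s ⊑ s′ × Resolved τ s′
  resolve τ (Γ ⊬ Δ by ¬d) with resolution τ ¬d
  ... | Γ′ , Δ′ , ρ , ¬d′ =
    ((Γ′ ++ Γ) ⊬ Δ′ ++ Δ by ¬d′) , (∈-++⁺ʳ Γ′ , ∈-++⁺ʳ Δ′) , Γ′ , Δ′ , ρ , ∈-++⁺ˡ , ∈-++⁺ˡ

  resolveAll : ∀ τs s → ∃[ s′ ] s ⊑ s′ × (∀ {τ} → τ ∈ τs → Resolved τ s′)
  resolveAll []       s = s , ⊑-refl , λ ()
  resolveAll (τ ∷ τs) s with resolve τ s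
  ... | s₁ , s⊑s₁ , r with resolveAll τs s₁
  ... | s₂ , s₁⊑s₂ , rs = s₂ , ⊑-trans s⊑s₁ s₁⊑s₂ , λ where
    (here refl) → Resolved-mono s₁⊑s₂ r
    (there τ∈)  → rs τ∈

  module Limit (s₀ : Unprovable) where

    stage : ℕ → Unprovable
    stage zero    = s₀
    stage (suc n) = proj₁ (resolveAll (tasks n) (stage n))

    stage-suc : ∀ n → stage n ⊑ stage (suc n)
    stage-suc n = proj₁ (proj₂ (resolveAll (tasks n) (stage n)))

    stage-+ : ∀ m n → stage n ⊑ stage (m + n)
    stage-+ zero    n = ⊑-refl
    stage-+ (suc m) n = ⊑-trans (stage-+ m n) (stage-suc (m + n))

    stage-mono : m ≤ n → stage m ⊑ stage n
    stage-mono {m} {n} m≤n = transport (λ k → stage m ⊑ stage k) (m∸n+n≡m m≤n) (stage-+ (n ∸ m) m)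

    L R : Formula → Set
    L A = ∃[ n ] A ∈ left (stage n)
    R A = ∃[ n ] A ∈ right (stage n)

    resolved : ∀ τ → ∃₂ λ Γ Δ → Resolves τ Γ Δ × All L Γ × All R Δ
    resolved τ with ev-tasks τ
    -- Stage `suc N` settles all of `tasks N`, hence `τ` as soon as `N` is a level at which `τ` is
    -- listed.
    ... | N , τ∈ with proj₂ (proj₂ (resolveAll (tasks N) (stage N))) (τ∈ ≤-refl)
    ... | Γ , Δ , ρ , Γ⊆ , Δ⊆ = Γ , Δ , ρ , All.tabulate (λ A∈ → suc N , Γ⊆ A∈) , All.tabulate (λ A∈ → suc N , Δ⊆ A∈)

    eventually-⊆ : (side : Unprovable → List Formula) → (∀ {s s′} → s ⊑ s′ → side s ⊆ side s′) →
                   All (λ A → ∃[ n ] A ∈ side (stage n)) Γ → ∃[ n ] Γ ⊆ side (stage n)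
    eventually-⊆ side mono []              = 0 , λ ()
    eventually-⊆ side mono ((m , A∈) ∷ As) with eventually-⊆ side mono As
    ... | n , Γ⊆ = m ⊔ n , λ where
      (here refl) → mono (stage-mono (m≤m⊔n m n)) A∈
      (there B∈)  → mono (stage-mono (m≤n⊔m m n)) (Γ⊆ B∈)

    -- A derivation may have infinite height, but its end sequent is finite, so all of its formulas
    -- are present at a single stage, and that stage is unprovable.
    consistent : Γ ⊢ Δ → All L Γ → All R Δ → ⊥
    consistent d ls rs with eventually-⊆ left left-⊆ ls | eventually-⊆ right right-⊆ rs
    ... | m , Γ⊆ | n , Δ⊆ = unprovable (stage (m ⊔ n))
      (⊢-mono (left-⊆ (stage-mono (m≤m⊔n m n)) ∘ Γ⊆) (right-⊆ (stage-mono (m≤n⊔m m n)) ∘ Δ⊆) d)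

  -- Complete theories

  module Completion (L R : Formula → Set)
                    (consistent : ∀ {Γ Δ} → Γ ⊢ Δ → All L Γ → All R Δ → ⊥)
                    (resolved : ∀ τ → ∃₂ λ Γ Δ → Resolves τ Γ Δ × All L Γ × All R Δ) where

    exclusive : L A → R A → ⊥
    exclusive l r = consistent id (l ∷ []) (r ∷ [])

    decided : (π : Label κ) (φ : Form κ) → L (π ▸ φ) ⊎ R (π ▸ φ)
    decided π φ with resolved (decide π φ)
    ... | _ , _ , holds , l ∷ [] , _ = inj₁ l
    ... | _ , _ , fails , _ , r ∷ [] = inj₂ r

    -- Each formula of the succedent is decided; if all of them fell into `R`, consistency would be
    -- violated. Allowing several formulas makes axioms such as linearity usable directly.
    derive* : (π : Label κ) (φs : List (Form κ)) → Γ ⊢ π ▸▸ φs → All L Γ → Any (L ∘ (π ▸_)) φs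
    derive* π φs d ls = [ (λ l → l) , (λ rs → contradiction (All.map⁺ rs) (consistent d ls)) ]′ (anyL φs)
      where
      anyL : ∀ φs → Any (L ∘ (π ▸_)) φs ⊎ All (R ∘ (π ▸_)) φs
      anyL []       = inj₂ []
      anyL (φ ∷ φs) with decided π φ | anyL φs
      ... | inj₁ l | _       = inj₁ (here l)
      ... | inj₂ r | inj₁ l  = inj₁ (there l)
      ... | inj₂ r | inj₂ rs = inj₂ (r ∷ rs)

    derive : (π : Label κ) {φ : Form κ} → Γ ⊢ (π ▸ φ) ∷ [] → All L Γ → L (π ▸ φ)
    derive π d ls with derive* π _ d ls
    ... | here l = l

    ∼-⇔ : (π : Label κ) {φ : Form κ} → L (π ▸ ∼ φ) ⇔ (¬ L (π ▸ φ))
    ∼-⇔ π {φ} = mk⇔ (λ l∼ l → consistent (∼L π φ id) (l∼ ∷ l ∷ []) []) λ ¬l →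
      -- The excluded middle is provable as a sequent with two formulas on the right, so one of the
      -- two lies in `L`. The case of `⇒` uses the same device with `φ ⇒ χ` and `φ`.
      case derive* π (∼ φ ∷ φ ∷ []) (∼R π φ id) [] of λ where
        (here l)         → l
        (there (here l)) → contradiction l ¬l

    module _ (π : Label κ) {φ χ : Form κ} where

      ∧-⇔ : L (π ▸ φ ∧ χ) ⇔ (L (π ▸ φ) × L (π ▸ χ))
      ∧-⇔ = mk⇔
        (λ l → derive π (∧L π φ χ (assumption first first)) (l ∷ []) ,
               derive π (∧L π φ χ (assumption second first)) (l ∷ []))
        λ (l , l′) → derive π (∧R π φ χ (assumption first first) (assumption second first)) (l ∷ l′ ∷ [])

      ∨-⇔ : L (π ▸ φ ∨ χ) ⇔ (L (π ▸ φ) ⊎ L (π ▸ χ))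
      ∨-⇔ = mk⇔
        (λ l → case derive* π (φ ∷ χ ∷ []) (∨L π φ χ (assumption first first) (assumption first second)) (l ∷ []) of λ where
          (here l)         → inj₁ l
          (there (here l)) → inj₂ l)
        [ (λ l → derive π (∨R π φ χ (assumption first first)) (l ∷ []))
        , (λ l → derive π (∨R π φ χ (assumption first second)) (l ∷ [])) ]′

      ⇒-⇔ : L (π ▸ φ ⇒ χ) ⇔ (L (π ▸ φ) → L (π ▸ χ))
      ⇒-⇔ = mk⇔
        (λ l l′ → derive π (⇒L π φ χ (assumption first first) (assumption first first)) (l ∷ l′ ∷ []))
        λ h → case derive* π ((φ ⇒ χ) ∷ φ ∷ []) (⇒R π φ χ (assumption first second)) [] of λ where
          (here l)         → l
          (there (here l)) → derive π (⇒R π φ χ (assumption second first)) (h l ∷ [])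

    module _ (π : Label (rel ℒ 0)) {φ : Form (rel ℒ 1)} where

      -- Free variables act as Henkin constants: unless the universal formula was put on the left,
      -- some instance at a variable was put on the right, against the assumption on all terms. The
      -- box equivalences below follow the same pattern, with the bounds as extra hypotheses.
      ∀-⇔ : L (π ▸ ∀∙ φ) ⇔ (∀ t → L (π ▸ φ ⟨ t ⟩))
      ∀-⇔ = mk⇔ (λ l t → derive π (∀L π φ t id) (l ∷ [])) λ h → case resolved (all π φ) of λ where
        (_ , _ , ∀-true    , l ∷ [] , _) → l
        (_ , _ , ∀-false x , _ , r ∷ []) → contradiction r (exclusive (h (free x)))

      ∃-⇔ : L (π ▸ ∃∙ φ) ⇔ (∃[ t ] L (π ▸ φ ⟨ t ⟩))
      ∃-⇔ = mk⇔
        (λ l → case resolved (ex π φ) of λ where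
          (_ , _ , ∃-true x , l′ ∷ [] , _) → free x , l′
          (_ , _ , ∃-false  , _ , r ∷ [])  → contradiction r (exclusive l))
        λ (t , l) → derive π (∃R π φ t id) (l ∷ [])

    cofinality : (π : Label (rel ℒ 0)) (t : Term ℒ 0) → ∃[ n ] L (π ▸ t ≺ f^ n c)
    cofinality π t with resolved (cofinal π t)
    ... | _ , _ , below n , l ∷ [] , _ = n , l

    □ᵉ-⇔ : ∀ {I T α} → L (inLab T ▸ □ᵉ I α) ⇔ (∀ S → All (L ∘ (ε ▸_)) (bounds I T S) → L (inLab S ▸ α))
    □ᵉ-⇔ {I} {T} {α} = mk⇔
      (λ l S bs → derive (inLab S)
        (□ᵉL I T S α (All.tabulate λ φ∈ → assumption (∈-map⁺ (ε ▸_) φ∈) first) (assumption first first))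
        (l ∷ All.map⁺ bs))
      λ h → case resolved (boxᵉ I T α) of λ where
        (_ , _ , □ᵉ-true , l ∷ [] , _) → l
        (_ , _ , □ᵉ-false X , bs , r ∷ []) → contradiction r (exclusive (h (free X) (All.map⁻ bs)))

    □ⁱ-⇔ : ∀ {I T t η} →
           L (inTemp T t ▸ □ⁱ I η) ⇔ (∀ s → All (L ∘ (inRel T ▸_)) (bounds I t s) → L (inTemp T s ▸ η))
    □ⁱ-⇔ {I} {T} {t} {η} = mk⇔
      (λ l s bs → derive (inTemp T s)
        (□ⁱL I T t s η (All.tabulate λ φ∈ → assumption (∈-map⁺ (inRel T ▸_) φ∈) first) (assumption first first))
        (l ∷ All.map⁺ bs))
      λ h → case resolved (boxⁱ I T t η) of λ where
        (_ , _ , □ⁱ-true , l ∷ [] , _) → l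
        (_ , _ , □ⁱ-false x , bs , r ∷ []) → contradiction r (exclusive (h (free x) (All.map⁻ bs)))

    -- Term models

    module TermModel (π : Label (rel ℒ 0)) where

      infix 4 _≈_ _⋖_

      _≈_ : Term ℒ 0 → Term ℒ 0 → Set
      s ≈ t = L (π ▸ s ≐ t)

      private variable
        s s′ t t′ u : Term ℒ 0

      ≈-refl : s ≈ s
      ≈-refl = derive π (eq-refl π _) []

      ≈-sym : s ≈ t → t ≈ s
      -- The instance reads: from `s ≐ t` and `s ≐ s` infer `t ≐ s`. The rewriting removes the
      -- weakenings of the terms that stay fixed.
      ≈-sym {s} {t} e with eq-subst π s t (bound zero ≐ weaken s) ≐-atomic
      ... | d rewrite substT-weaken s s | substT-weaken s t = derive π d (e ∷ ≈-refl ∷ [])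

      ≈-trans : s ≈ t → t ≈ u → s ≈ u
      ≈-trans {s} {t} {u} e e′ with eq-subst π t u (weaken s ≐ bound zero) ≐-atomic
      ... | d rewrite substT-weaken s t | substT-weaken s u = derive π d (e′ ∷ e ∷ [])

      -- Substitution into the atomic formula `f s ≐ f z` at the place `z` gives congruence from
      -- reflexivity.
      f-cong : s ≈ t → f s ≈ f t
      f-cong {s} {t} e with eq-subst π s t (f (weaken s) ≐ f (bound zero)) ≐-atomic
      ... | d rewrite substT-weaken s s | substT-weaken s t = derive π d (e ∷ ≈-refl ∷ [])

      ≺-resp : s ≈ s′ → t ≈ t′ → L (π ▸ s ≺ t) → L (π ▸ s′ ≺ t′)
      ≺-resp {s} {s′} {t} {t′} e e′ l
        with eq-subst π s s′ (bound zero ≺ weaken t) ≺-atomic | eq-subst π t t′ (weaken s′ ≺ bound zero) ≺-atomic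
      ... | d | d′ rewrite substT-weaken t s | substT-weaken t s′ | substT-weaken s′ t | substT-weaken s′ t′ =
        derive π d′ (e′ ∷ derive π d (e ∷ l ∷ []) ∷ [])

      Class : Term ℒ 0 → ℕ → Set
      Class t n = ∃[ s ] code s ≡ n × t ≈ s

      abstract
        leastCode : (t : Term ℒ 0) → ∃[ n ] Class t n × (∀ m → Class t m → n ≤ m)
        leastCode t = least em (Class t) (code t) (t , refl , ≈-refl)

        rep : Term ℒ 0 → Term ℒ 0
        rep t = proj₁ (proj₁ (proj₂ (leastCode t)))

        ≈-rep : t ≈ rep t
        ≈-rep {t} = proj₂ (proj₂ (proj₁ (proj₂ (leastCode t))))

        -- `rep t` lies in the class of `s` as well, so its code is at least the least one there.
        -- With symmetry and the injectivity of `code`, equal terms get the same representative.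
        code-rep-≤ : s ≈ t → code (rep s) ≤ code (rep t)
        code-rep-≤ {s} {t} e with leastCode s
        ... | _ , (_ , refl , _) , min = min _ (rep t , refl , ≈-trans e ≈-rep)

        rep-cong : s ≈ t → rep s ≡ rep t
        rep-cong e = code-injective _ _ (≤-antisym (code-rep-≤ e) (code-rep-≤ (≈-sym e)))

      -- The quotient by `_≈_` is realised as the set of canonical terms, so that equality of points
      -- is propositional equality, as `Admissible` demands. Irrelevance of the second field makes a
      -- point determined by its term.
      record Point : Set where
        constructor point
        field
          term       : Term ℒ 0
          .canonical : rep term ≡ term

      open Point public using (term)

      [_] : Term ℒ 0 → Point
      [ t ] = point (rep t) (sym (rep-cong ≈-rep))

      point-cong : {a b : Point} → term a ≡ term b → a ≡ b
      point-cong refl = refl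

      []-term : (a : Point) → [ term a ] ≡ a
      -- Excluded middle decides the equation, which turns its irrelevant proof into a usable one.
      []-term (point _ canonical) = point-cong (recompute em canonical)

      ≡-⇔ : ([ s ] ≡ [ t ]) ⇔ (s ≈ t)
      ≡-⇔ = mk⇔
        (λ eq → ≈-trans ≈-rep (transport (_≈ _) (cong term (sym eq)) (≈-sym ≈-rep)))
        (λ e → point-cong (rep-cong e))

      _⋖_ : Point → Point → Set
      a ⋖ b = L (π ▸ term a ≺ term b)

      ⋖-⇔ : ([ s ] ⋖ [ t ]) ⇔ L (π ▸ s ≺ t)
      ⋖-⇔ = mk⇔ (≺-resp (≈-sym ≈-rep) (≈-sym ≈-rep)) (≺-resp ≈-rep ≈-rep)

      term-injective : {a b : Point} → term a ≈ term b → a ≡ b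
      term-injective e = trans (sym ([]-term _)) (trans (from ≡-⇔ e) ([]-term _))

      next : Point → Point
      next a = [ f (term a) ]

      next-[] : next [ t ] ≡ [ f t ]
      next-[] = from ≡-⇔ (f-cong (≈-sym ≈-rep))

      next^-[] : ∀ n → fold [ t ] next n ≡ [ f^ n t ]
      next^-[] zero    = refl
      next^-[] (suc n) = trans (cong next (next^-[] n)) next-[]

      ⋖-irrefl : {a : Point} → ¬ (a ⋖ a)
      ⋖-irrefl l = consistent (<-irrefl π _) (l ∷ []) []

      ⋖-trans : {a b d : Point} → a ⋖ b → b ⋖ d → a ⋖ d
      ⋖-trans l l′ = derive π (<-trans π _ _ _) (l ∷ l′ ∷ [])

      ⋖-next : (a : Point) → a ⋖ next a
      ⋖-next a = ≺-resp ≈-refl ≈-rep (derive π (f-incr π (term a)) [])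

      ⋖-compare : (a b : Point) → Tri (a ⋖ b) (a ≡ b) (b ⋖ a)
      ⋖-compare a b with derive* π _ (<-linear π (term a) (term b)) []
      ... | (here l) = tri< l (λ { refl → ⋖-irrefl {a} l }) (λ l′ → ⋖-irrefl {a} (⋖-trans {a} {b} {a} l l′))
      ... | there (here e) with term-injective {a} {b} e
      ...   | refl = tri≈ (⋖-irrefl {a}) refl (⋖-irrefl {a})
      ⋖-compare a b | there (there (here l)) =
        tri> (λ l′ → ⋖-irrefl {a} (⋖-trans {a} {b} {a} l′ l)) (λ { refl → ⋖-irrefl {a} l }) l

      ⋖-dense : {a b : Point} → a ⋖ b → ∃[ d ] a ⋖ d × d ⋖ b
      ⋖-dense {a} {b} l with to (∃-⇔ π) (derive π (<-dense π (term a) (term b)) (l ∷ []))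
      ... | t , l′ with to (∧-⇔ π) l′
      ... | l₁ , l₂ rewrite substT-weaken (term a) t | substT-weaken (term b) t =
        [ t ] , ≺-resp ≈-refl ≈-rep l₁ , ≺-resp ≈-rep ≈-refl l₂

      ⋖-cofinal : (a : Point) → ∃[ n ] a ⋖ fold [ c ] next n
      ⋖-cofinal a with cofinality π (term a)
      ... | n , l = n , transport (a ⋖_) (sym (next^-[] n)) (≺-resp ≈-refl ≈-rep l)

      model : Admissible
      model = record
        { Carrier = Point
        ; _<_ = _⋖_
        ; 0# = [ c ]
        ; g = next
        ; isDenseLinearOrder = record
          { isStrictTotalOrder = record
            { isStrictPartialOrder = record
              { isEquivalence = isEquivalence
              ; irrefl = λ { {a} refl → ⋖-irrefl {a} }
              ; trans = λ {a} {b} {d} → ⋖-trans {a} {b} {d}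
              ; <-resp-≈ = (λ { refl l → l }) , λ { refl l → l }
              }
            ; compare = ⋖-compare
            }
          ; dense = λ {a} {b} → ⋖-dense {a} {b}
          }
        ; 0-least = λ a → case derive* π _ (c-least π (term a)) [] of λ where
            (here l)         → inj₁ (≺-resp ≈-rep ≈-refl l)
            (there (here e)) → inj₂ (trans (from ≡-⇔ e) ([]-term a))
        ; no-greatest = λ (a , max) → case max (next a) of λ where
            (inj₁ l)  → ⋖-irrefl {a} (⋖-trans {a} {next a} {a} (⋖-next a) l)
            (inj₂ eq) → ⋖-irrefl {a} (transport (a ⋖_) eq (⋖-next a))
        ; g-strictMono = λ l → ≺-resp ≈-rep ≈-rep (derive π (f-mono π _ _) (l ∷ []))
        ; g-incr = ⋖-next
        ; g-cofinal = λ a → let n , l = ⋖-cofinal a in n , inj₁ l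
        }

      value-[] : (θ : Vec (Term ℒ 0) k) (t : Term ℒ k) →
                 value model ([_] ∘ free) (Vec.map [_] θ) t ≡ [ substT (lookup θ) t ]
      value-[] θ (free x)  = refl
      value-[] θ (bound i) = lookup-map i [_] θ
      value-[] θ c         = refl
      value-[] θ (f t)     = trans (cong next (value-[] θ t)) next-[]

      -- π′ is a label naming the same structure as π.
      module Truth (π′ : Label (rel ℒ 0))
                   (same : ∀ {η} → Atomic η → L (π ▸ η) ⇔ L (π′ ▸ η)) where

        ≐-truth : ([ s ] ≡ [ t ]) ⇔ L (π′ ▸ s ≐ t)
        ≐-truth = same ≐-atomic ⇔-∘ ≡-⇔

        ≺-truth : ([ s ] ⋖ [ t ]) ⇔ L (π′ ▸ s ≺ t)
        ≺-truth = same ≺-atomic ⇔-∘ ⋖-⇔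

        -- Bound variables are assigned classes of the terms in `θ`, which makes induction under
        -- binders possible. Every point is the class of its own term by `[]-term`, so quantifying
        -- over points agrees with quantifying over terms as in `∀-⇔` and `∃-⇔`.
        SatFO-truth : (θ : Vec (Term ℒ 0) k) (φ : Form (rel ℒ k)) →
                      SatFO model ([_] ∘ free) (Vec.map [_] θ) φ ⇔ L (π′ ▸ subst (lookup θ) φ)
        SatFO-truth θ (s ≐ t) rewrite value-[] θ s | value-[] θ t = ≐-truth
        SatFO-truth θ (s ≺ t) rewrite value-[] θ s | value-[] θ t = ≺-truth
        SatFO-truth θ (∀∙ φ)  = mk⇔
          (λ h → from (∀-⇔ π′) λ t →
            transport (L ∘ (π′ ▸_)) (sym (subst-lift-⟨⟩ θ φ t)) (to (SatFO-truth (t ∷ θ) φ) (h [ t ])))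
          λ l d → transport (λ e → SatFO model ([_] ∘ free) (e ∷ Vec.map [_] θ) φ) ([]-term d)
            (from (SatFO-truth (term d ∷ θ) φ)
              (transport (L ∘ (π′ ▸_)) (subst-lift-⟨⟩ θ φ (term d)) (to (∀-⇔ π′) l (term d))))
        SatFO-truth θ (∃∙ φ)  = mk⇔
          (λ (d , h) → from (∃-⇔ π′) (term d ,
            transport (L ∘ (π′ ▸_)) (sym (subst-lift-⟨⟩ θ φ (term d))) (to (SatFO-truth (term d ∷ θ) φ)
              (transport (λ e → SatFO model ([_] ∘ free) (e ∷ Vec.map [_] θ) φ) (sym ([]-term d)) h))))
          λ l → case to (∃-⇔ π′) l of λ (t , l′) →
            [ t ] , from (SatFO-truth (t ∷ θ) φ) (transport (L ∘ (π′ ▸_)) (subst-lift-⟨⟩ θ φ t) l′)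
        SatFO-truth θ (∼ φ)   = ⇔-sym (∼-⇔ π′) ⇔-∘ ¬-cong-⇔ (SatFO-truth θ φ)
        SatFO-truth θ (φ ∧ χ) = ⇔-sym (∧-⇔ π′) ⇔-∘ (SatFO-truth θ φ ×-⇔ SatFO-truth θ χ)
        SatFO-truth θ (φ ∨ χ) = ⇔-sym (∨-⇔ π′) ⇔-∘ (SatFO-truth θ φ ⊎-⇔ SatFO-truth θ χ)
        SatFO-truth θ (φ ⇒ χ) = ⇔-sym (⇒-⇔ π′) ⇔-∘ →-cong-⇔ (SatFO-truth θ φ) (SatFO-truth θ χ)

        sentence-truth : (φ : Form (rel ℒ 0)) → SatFO model ([_] ∘ free) [] φ ⇔ L (π′ ▸ φ)
        sentence-truth φ = transport (λ χ → SatFO model ([_] ∘ free) [] φ ⇔ L (π′ ▸ χ))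
          (subst-id (λ ()) φ) (SatFO-truth [] φ)

        compare-truth : ∀ l → Admissible.compare model l [ s ] [ t ] ⇔ L (π′ ▸ cmp l s t)
        compare-truth closed = ⇔-sym (∨-⇔ π′) ⇔-∘ (≺-truth ⊎-⇔ ≐-truth)
        compare-truth open′  = ≺-truth

        Within-truth : ∀ I → Admissible.Within model I [ t ] [ s ] ⇔ All (L ∘ (π′ ▸_)) (bounds I t s)
        Within-truth {t} (bounded l r m n _) rewrite next^-[] {t} m | next^-[] {t} n = mk⇔
          (λ (w , w′) → to (compare-truth l) w ∷ to (compare-truth r) w′ ∷ [])
          λ { (b ∷ b′ ∷ []) → from (compare-truth l) b , from (compare-truth r) b′ }
        Within-truth {t} (unbounded l m) rewrite next^-[] {t} m = mk⇔
          (λ w → to (compare-truth l) w ∷ [])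
          λ { (b ∷ []) → from (compare-truth l) b }

    -- The two-level term structure and its truth lemma

    open TermModel using (model; term)

    module Ext = TermModel ε
    module Int (T : Tₑ) = TermModel (inRel T)

    -- The internal structure must depend on the point alone, so it is built under the label given
    -- by the canonical term of that point; predicates are likewise read off at canonical terms.
    structure : Structure
    structure = record
      { 𝐌  = Ext.model
      ; 𝐍  = λ a → Int.model (term a)
      ; P  = λ a n b → L (inTemp (term a) (term b) ▸ p n)
      ; σ  = Ext.[_] ∘ free
      ; σᵢ = λ a → Int.[_] (term a) ∘ free
      }

    value-ext : (T : Tₑ) → value Ext.model (Ext.[_] ∘ free) [] T ≡ Ext.[ T ]
    value-ext T = trans (Ext.value-[] [] T) (cong Ext.[_] (substT-id (λ ()) T))

    value-int : (S : Tₑ) (t : Tᵢ) → value (Int.model S) (Int.[_] S ∘ free) [] t ≡ Int.[_] S t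
    value-int S t = trans (Int.value-[] S [] t) (cong (Int.[_] S) (substT-id (λ ()) t))

    module ExtTruth = Ext.Truth ε (λ _ → mk⇔ (λ l → l) (λ l → l))

    -- T is any label naming the point of S.
    module _ {S T : Tₑ} (S≈T : S Ext.≈ T) where

      same-label : ∀ {η} → Atomic η → L (inRel S ▸ η) ⇔ L (inRel T ▸ η)
      same-label {η} at = mk⇔ (λ l → derive (inRel T) (eq-rel S T η at) (S≈T ∷ l ∷ []))
                              (λ l → derive (inRel S) (eq-rel T S η at) (Ext.≈-sym S≈T ∷ l ∷ []))

      module IntTruth = Int.Truth S (inRel T) same-label

      -- The internal term is exchanged by `eq-prop` under the label `S`, and the label by `eq-lab`.
      p-truth : ∀ n t → L (inTemp S (term (Int.[_] S t)) ▸ p n) ⇔ L (inTemp T t ▸ p n)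
      p-truth n t = mk⇔
        (λ l → derive (inLab T) (eq-lab S T (t ∶ p n) ∶-atomic)
          (S≈T ∷ derive (inTemp S t) (eq-prop S _ t n) (Int.≈-sym S (Int.≈-rep S) ∷ l ∷ []) ∷ []))
        (λ l → derive (inTemp S _) (eq-prop S t _ n) (Int.≈-rep S
          ∷ derive (inLab S) (eq-lab T S (t ∶ p n) ∶-atomic) (Ext.≈-sym S≈T ∷ l ∷ []) ∷ []))

      SatTemp-truth : (t : Tᵢ) (ψ : Form temp) →
        SatTemp (Int.model S) (λ n b → L (inTemp S (term b) ▸ p n)) (Int.[_] S t) ψ ⇔ L (inTemp T t ▸ ψ)
      SatTemp-truth t (p n)    = p-truth n t
      SatTemp-truth t (□ⁱ I ψ) = mk⇔
        (λ h → from □ⁱ-⇔ λ s bs → to (SatTemp-truth s ψ) (h (Int.[_] S s) (from (IntTruth.Within-truth I) bs)))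
        λ l d → transport (λ e → Admissible.Within (Int.model S) I (Int.[_] S t) e → SatTemp (Int.model S) _ e ψ)
          (Int.[]-term S d)
          λ w → from (SatTemp-truth (term d) ψ) (to □ⁱ-⇔ l (term d) (to (IntTruth.Within-truth I) w))
      SatTemp-truth t (∼ ψ)    = ⇔-sym (∼-⇔ (inTemp T t)) ⇔-∘ ¬-cong-⇔ (SatTemp-truth t ψ)
      SatTemp-truth t (ψ ∧ χ)  = ⇔-sym (∧-⇔ (inTemp T t)) ⇔-∘ (SatTemp-truth t ψ ×-⇔ SatTemp-truth t χ)
      SatTemp-truth t (ψ ∨ χ)  = ⇔-sym (∨-⇔ (inTemp T t)) ⇔-∘ (SatTemp-truth t ψ ⊎-⇔ SatTemp-truth t χ)
      SatTemp-truth t (ψ ⇒ χ)  = ⇔-sym (⇒-⇔ (inTemp T t)) ⇔-∘ →-cong-⇔ (SatTemp-truth t ψ) (SatTemp-truth t χ)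

    rep≈ : (T : Tₑ) → term Ext.[ T ] Ext.≈ T
    rep≈ T = Ext.≈-sym Ext.≈-rep

    -- The term `T` stays arbitrary in the induction because a box moves to other terms. At `t ∶ ψ`
    -- the structure uses the representative of `T`, and `rep≈` hands the passage back to `T` over
    -- to `SatTemp-truth`.
    SatLab-truth : (T : Tₑ) (α : Form lab) → SatLab structure Ext.[ T ] α ⇔ L (inLab T ▸ α)
    SatLab-truth T (t ∶ ψ) rewrite value-int (term Ext.[ T ]) t = SatTemp-truth (rep≈ T) t ψ
    SatLab-truth T (□ᵉ I α) = mk⇔
      (λ h → from □ᵉ-⇔ λ S bs → to (SatLab-truth S α) (h Ext.[ S ] (from (ExtTruth.Within-truth I) bs)))
      λ l d → transport (λ e → Admissible.Within Ext.model I Ext.[ T ] e → SatLab structure e α) (Ext.[]-term d)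
        λ w → from (SatLab-truth (term d) α) (to □ᵉ-⇔ l (term d) (to (ExtTruth.Within-truth I) w))
    SatLab-truth T (∼ α)    = ⇔-sym (∼-⇔ (inLab T)) ⇔-∘ ¬-cong-⇔ (SatLab-truth T α)
    SatLab-truth T (α ∧ β)  = ⇔-sym (∧-⇔ (inLab T)) ⇔-∘ (SatLab-truth T α ×-⇔ SatLab-truth T β)
    SatLab-truth T (α ∨ β)  = ⇔-sym (∨-⇔ (inLab T)) ⇔-∘ (SatLab-truth T α ⊎-⇔ SatLab-truth T β)
    SatLab-truth T (α ⇒ β)  = ⇔-sym (⇒-⇔ (inLab T)) ⇔-∘ →-cong-⇔ (SatLab-truth T α) (SatLab-truth T β)

    -- These two implications are what refuting a sequent takes. Equivalence with membership in `L`
    -- would be too strong: an infinitary formula is true in the structure, yet may lie in neither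
    -- `L` nor `R`.
    Agrees : Set → Formula → Set
    Agrees Q A = (L A → Q) × (R A → ¬ Q)

    ⇔⇒agrees : {Q : Set} → Q ⇔ L A → Agrees Q A
    ⇔⇒agrees e = from e , λ r q → exclusive (to e q) r

    theorem-agrees : {Q : Set} → [] ⊢ A ∷ [] → Q → Agrees Q A
    theorem-agrees d q = (λ _ → q) , λ r → contradiction (r ∷ []) (consistent d [])

    module _ (π π′ : Label (rel ℒ 0)) (same : ∀ {η} → Atomic η → L (π ▸ η) ⇔ L (π′ ▸ η)) where
      open TermModel π using ([_]; ⋖-cofinal; module Truth)

      ▸≡▹ : {φ : Form (rel ℒ 0)} (π : Label (rel ℒ 0)) → (π ▸ φ) ≡ (π ▹ fin φ)
      ▸≡▹ ε         = refl
      ▸≡▹ (inRel T) = refl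

      SatRel-agrees : (ρ : RelForm ℒ) → Agrees (SatRel (model π) ([_] ∘ free) ρ) (π′ ▹ ρ)
      SatRel-agrees (fin φ)    = transport (Agrees _) (▸≡▹ π′) (⇔⇒agrees (Truth.sentence-truth π′ same φ))
      SatRel-agrees ⋁[ t <fⁿc] = theorem-agrees (f-cofinal π′ t) (⋖-cofinal (value (model π) ([_] ∘ free) [] t))
      -- Both contexts are empty, so the variable 0 satisfies the eigenvariable condition.
      SatRel-agrees ∀⋁         = theorem-agrees (∀⋁R π′ 0 (λ ()) (f-cofinal π′ _)) ⋖-cofinal

    Sat-agrees : ∀ A → Agrees (Sat structure A) A
    Sat-agrees (rel ρ) = SatRel-agrees ε ε (λ _ → mk⇔ (λ l → l) (λ l → l)) ρ
    Sat-agrees (T ∶ rel ρ) rewrite value-ext T = SatRel-agrees _ (inRel T) (same-label (rep≈ T)) ρ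
    Sat-agrees (T ∶ lab α) rewrite value-ext T = ⇔⇒agrees (SatLab-truth T α)

    False : All L Γ → All R Δ → ¬ True structure Γ Δ
    False ls rs (inj₁ ¬A) with All.lookupAny ls ¬A
    ... | l , ¬sat = ¬sat (proj₁ (Sat-agrees _) l)
    False ls rs (inj₂ A) with All.lookupAny rs A
    ... | r , sat = proj₂ (Sat-agrees _) r sat

-- Completeness, by a countermodel to each unprovable sequent

corollary5p2 : ExcludedMiddle 0ℓ → (Γ Δ : List Formula) → Valid Γ Δ → Γ ⊢ Δ
corollary5p2 em Γ Δ valid with em {Γ ⊢ Δ}
... | yes d = d
... | no ¬d = contradiction (valid structure)
  -- Stage 0 is the given sequent itself, so all of its formulas already lie in `L` and `R`.
  (False (All.tabulate (λ A∈ → 0 , A∈)) (All.tabulate (λ A∈ → 0 , A∈)))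
  where
  open Limit em (Γ ⊬ Δ by ¬d)
  open Completion em L R consistent resolved
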